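{- Suppose that $D_1$ and $D_2$ are link shadow diagrams, and let $D_1\# D_2$ be a connect sum of them. With respect to the Link Smoothing Game: \begin{enumerate} \item If $D_1$ and $D_2$ are both $\mathcal{P}$-position, then $D_1\# D_2$ is $\mathcal{P}$-position. \item If $D_1$ is $\mathcal{P}$-position and $D_2$ is $\mathcal{N}$-position, then $D_1\# D_2$ is $\mathcal{N}$-position. \item If $D_1$ and $D_2$ are both $\mathcal{N}$-position, then $D_1\# D_2$ is $L$-position. \item Any connect sum with an $L$-position summand is $L$-position. \end{enumerate}
   Context: A link shadow $D$ is a connected link diagram in which under/over information is unspecified at the crossings (called precrossings). Link Smoothing Game on $D$: two players, $K$ (Knot) and $L$ (Link), alternately select a remaining precrossing and replace it by either of its two smoothings (horizontal or vertical), until no precrossings remain. $K$ wins if the final diagram is connected; $L$ wins if it is disconnected (once disconnected, the diagram stays disconnected). Graph of a shadow: checkerboard color the regions of $D$; the (black) graph $G$ has one vertex per black region and one edge per precrossing, joining the black regions meeting there (loops and multi-edges allowed). $G$ is a connected plane graph; the white graph is its planar dual $G^*$. Every connected plane graph arises in this way. Smoothing a precrossing amounts to either deleting the corresponding edge of $G$ (and contracting the dual edge in $G^*$) or contracting it in $G$ (and deleting the dual edge in $G^*$). The shadow is connected if and only if both graphs are connected. Thus, on $G$, players alternately choose a remaining edge and delete or contract it; $L$ wins as soon as a cut edge is deleted or a loop is contracted (the latter deletes a cut edge of the dual), and $K$ wins if all edges are used up without this ever happening. Outcome classes: a shadow is in $\mathcal{N}$-position if the first player to move (whichever of $K$, $L$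 that is) can guarantee a win; $\mathcal{P}$-position if the second player to move can guarantee a win; $L$-position if $L$ can guarantee a win whether moving first or second. Connect sum: $D_1\# D_2$ is obtained from the diagrams $D_1$ and $D_2$ by removing a small arc segment from an exterior arc of each diagram and connecting the two diagrams at the newly formed endpoints by a pair of parallel curves. On the level of graphs, if $G_1,G_2$ are the black graphs of $D_1,D_2$, then the black graph of $D_1\# D_2$ is the wedge $G_1\vee G_2$, obtained by identifying an exterior vertex of $G_1$ with an exterior vertex of $G_2$. -}

module Defs where

open import Data.Bool.Base using (if_then_else_)
open import Data.Empty using (⊥-elim)
open import Data.Fin.Base using (Fin; splitAt; _↑ˡ_; _↑ʳ_)
open import Data.Fin.Patterns using (0F; 1F; 2F; 3F)
open import Data.Fin.Properties using (splitAt-↑ˡ; splitAt-↑ʳ; splitAt⁻¹-↑ˡ; splitAt⁻¹-↑ʳ)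
  renaming (_≟_ to _≟F_)
open import Data.Maybe.Base using (Maybe; just; nothing)
open import Data.Nat.Base using (ℕ; _+_)
open import Data.Product.Base using (∃; _×_; _,_)
open import Data.Product.Properties using () renaming (≡-dec to ×-≡-dec)
open import Data.Sum.Base using (_⊎_; inj₁; inj₂; [_,_]′)
open import Data.Sum.Properties using (inj₁-injective; inj₂-injective) renaming (≡-dec to ⊎-≡-dec)
open import Data.Vec.Base using (Vec; lookup; replicate; _[_]≔_)
open import Function.Base using (_∘_)
open import Function.Bundles using (_⇔_)
open import Relation.Binary.Construct.Closure.Equivalence using (EqClosure)
open import Relation.Binary.Definitions using (DecidableEquality)
open import Relation.Binary.PropositionalEquality
  using (_≡_; _≢_; refl; sym; trans; cong)
open import Relation.Nullary using (¬_; does; yes; no)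

-- A diagram is a combinatorial map: `crossings` four-valent vertices (the
-- precrossings) and `marks` two-valent vertices, which are points marked on
-- strands and have no other significance.  Marked points are allowed so that
-- the crossingless circle is a diagram (one marked point, one arc).
-- The half-edges at a vertex are numbered counterclockwise.

HalfEdge : ℕ → ℕ → Set
HalfEdge n j = (Fin n × Fin 4) ⊎ (Fin j × Fin 2)

_≟_ : ∀ {n j} → DecidableEquality (HalfEdge n j)
_≟_ = ⊎-≡-dec (×-≡-dec _≟F_ _≟F_) (×-≡-dec _≟F_ _≟F_)

rotate₄ : Fin 4 → Fin 4
rotate₄ 0F = 1F
rotate₄ 1F = 2F
rotate₄ 2F = 3F
rotate₄ 3F = 0F

rotate₂ : Fin 2 → Fin 2
rotate₂ 0F = 1F
rotate₂ 1F = 0F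

rotate : ∀ {n j} → HalfEdge n j → HalfEdge n j
rotate (inj₁ (c , i)) = inj₁ (c , rotate₄ i)
rotate (inj₂ (q , i)) = inj₂ (q , rotate₂ i)

record Diagram : Set where
  field
    crossings      : ℕ
    marks          : ℕ
    -- the other half of the arc containing a given half-edge
    opp            : HalfEdge crossings marks → HalfEdge crossings marks
    opp-involutive : ∀ d → opp (opp d) ≡ d
    opp-fixfree    : ∀ d → opp d ≢ d

  Half : Set
  Half = HalfEdge crossings marks

  -- A half-edge d stands for the side of its arc that lies on the left when
  -- leaving the vertex of d.  The corner between d and rotate d is on the left
  -- of d and on the right of rotate d, hence on the left of opp (rotate d).
  data Corner : Half → Half → Set where
    corner : ∀ d → Corner d (opp (rotate d))

  SameRegion : Half → Half → Set
  SameRegion = EqClosure Corner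

open Diagram public

-- With the half-edges 0, 1, 2, 3 pointing NE, NW, SW, SE.

data Smoothing : Set where
  horizontal vertical : Smoothing

partner : Smoothing → Fin 4 → Fin 4
partner horizontal 0F = 1F
partner horizontal 1F = 0F
partner horizontal 2F = 3F
partner horizontal 3F = 2F
partner vertical   0F = 3F
partner vertical   1F = 2F
partner vertical   2F = 1F
partner vertical   3F = 0F

module Game (D : Diagram) where

  -- `nothing` at the crossings that are still precrossings
  Position : Set
  Position = Vec (Maybe Smoothing) (crossings D)

  start : Position
  start = replicate (crossings D) nothing

  Remaining : Position → Fin (crossings D) → Set
  Remaining p c = lookup p c ≡ nothing

  Final : Position → Set
  Final p = ∀ c → ¬ Remaining p c

  data Joined (p : Position) : Half D → Half D → Set where
    arc         : ∀ d → Joined p d (opp D d)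
    mark        : ∀ q i k → Joined p (inj₂ (q , i)) (inj₂ (q , k))
    precrossing : ∀ c → Remaining p c → ∀ i k →
                  Joined p (inj₁ (c , i)) (inj₁ (c , k))
    smoothed    : ∀ c s → lookup p c ≡ just s → ∀ i →
                  Joined p (inj₁ (c , i)) (inj₁ (c , partner s i))

  Connected : Position → Set
  Connected p = ∀ d e → EqClosure (Joined p) d e

data Player : Set where
  K L : Player

opponent : Player → Player
opponent K = L
opponent L = K

module _ (D : Diagram) where
  open Game D

  WinsAtEnd : Player → Position → Set
  WinsAtEnd K p = Connected p
  WinsAtEnd L p = ¬ Connected p

  -- CanWin X Y p : X has a winning strategy from position p with Y to move.
  data CanWin (X : Player) : Player → Position → Set where
    over  : ∀ {Y p} → Final p → WinsAtEnd X p → CanWin X Y p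
    move  : ∀ {p} c → Remaining p c → ∀ s →
            CanWin X (opponent X) (p [ c ]≔ just s) → CanWin X X p
    reply : ∀ {Y p} → Y ≢ X → ¬ Final p →
            (∀ c → Remaining p c → ∀ s → CanWin X X (p [ c ]≔ just s)) →
            CanWin X Y p

  WinsFirst WinsSecond : Player → Set
  WinsFirst  X = CanWin X X start
  WinsSecond X = CanWin X (opponent X) start

  N-position P-position L-position : Set
  N-position = WinsFirst K × WinsFirst L
  P-position = WinsSecond K × WinsSecond L
  L-position = WinsFirst L × WinsSecond L

-- A link shadow: a connected diagram in the plane with a distinguished
-- exterior region.  There are `marks + crossings` vertices and
-- `marks + 2 * crossings` arcs, so by Euler's formula a connected diagram is
-- planar exactly when it has `2 + crossings` regions.

record Shadow : Set where
  field
    diagram           : Diagram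
    connected         : Game.Connected diagram (Game.start diagram)
    region            : Half diagram → Fin (2 + crossings diagram)
    region-surjective : ∀ r → ∃ λ d → region d ≡ r
    region-correct    : ∀ d e → region d ≡ region e ⇔ SameRegion diagram d e
    exterior          : Fin (2 + crossings diagram)

  OnExterior : Half diagram → Set
  OnExterior d = region d ≡ exterior

open Shadow public

-- The connect sum of two diagrams along the arcs of the half-edges a and b.
-- The arcs a – opp a and b – opp b are replaced by a – opp b and b – opp a.
-- The left sides of a and b merge into one region and so do the right sides;
-- with the exterior on the left of both this is the connect sum in the plane.

module _ (D₁ D₂ : Diagram) where
  private
    n₁ = crossings D₁
    n₂ = crossings D₂
    j₁ = marks D₁
    j₂ = marks D₂

  join : Half D₁ ⊎ Half D₂ → HalfEdge (n₁ + n₂) (j₁ + j₂)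
  join (inj₁ (inj₁ (c , i))) = inj₁ (c ↑ˡ n₂ , i)
  join (inj₁ (inj₂ (q , i))) = inj₂ (q ↑ˡ j₂ , i)
  join (inj₂ (inj₁ (c , i))) = inj₁ (n₁ ↑ʳ c , i)
  join (inj₂ (inj₂ (q , i))) = inj₂ (j₁ ↑ʳ q , i)

  split : HalfEdge (n₁ + n₂) (j₁ + j₂) → Half D₁ ⊎ Half D₂
  split (inj₁ (c , i)) =
    [ (λ c₁ → inj₁ (inj₁ (c₁ , i))) , (λ c₂ → inj₂ (inj₁ (c₂ , i))) ]′ (splitAt n₁ c)
  split (inj₂ (q , i)) =
    [ (λ q₁ → inj₁ (inj₂ (q₁ , i))) , (λ q₂ → inj₂ (inj₂ (q₂ , i))) ]′ (splitAt j₁ q)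

  split-join : ∀ x → split (join x) ≡ x
  split-join (inj₁ (inj₁ (c , i))) rewrite splitAt-↑ˡ n₁ c n₂ = refl
  split-join (inj₁ (inj₂ (q , i))) rewrite splitAt-↑ˡ j₁ q j₂ = refl
  split-join (inj₂ (inj₁ (c , i))) rewrite splitAt-↑ʳ n₁ n₂ c = refl
  split-join (inj₂ (inj₂ (q , i))) rewrite splitAt-↑ʳ j₁ j₂ q = refl

  join-split : ∀ d → join (split d) ≡ d
  join-split (inj₁ (c , i)) with splitAt n₁ c in eq
  ... | inj₁ c₁ = cong (λ x → inj₁ (x , i)) (splitAt⁻¹-↑ˡ eq)
  ... | inj₂ c₂ = cong (λ x → inj₁ (x , i)) (splitAt⁻¹-↑ʳ eq)
  join-split (inj₂ (q , i)) with splitAt j₁ q in eq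
  ... | inj₁ q₁ = cong (λ x → inj₂ (x , i)) (splitAt⁻¹-↑ˡ eq)
  ... | inj₂ q₂ = cong (λ x → inj₂ (x , i)) (splitAt⁻¹-↑ʳ eq)

  module _ (a : Half D₁) (b : Half D₂) where

    reconnect : Half D₁ ⊎ Half D₂ → Half D₁ ⊎ Half D₂
    reconnect (inj₁ d) =
      if does (d ≟ a) then inj₂ (opp D₂ b)
      else if does (d ≟ opp D₁ a) then inj₂ b
      else inj₁ (opp D₁ d)
    reconnect (inj₂ e) =
      if does (e ≟ b) then inj₁ (opp D₁ a)
      else if does (e ≟ opp D₂ b) then inj₁ a
      else inj₂ (opp D₂ e)

    private
      opp-flip : ∀ D {d e : Half D} → opp D d ≡ e → d ≡ opp D e
      opp-flip D {d} eq = trans (sym (opp-involutive D d)) (cong (opp D) eq)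

      opp-injective : ∀ D {d e : Half D} → opp D d ≡ opp D e → d ≡ e
      opp-injective D {d} {e} eq = trans (opp-flip D eq) (opp-involutive D e)

    reconnect-involutive : ∀ x → reconnect (reconnect x) ≡ x
    reconnect-involutive (inj₁ d) with d ≟ a
    reconnect-involutive (inj₁ d) | yes refl with opp D₂ b ≟ b
    ... | yes eq = ⊥-elim (opp-fixfree D₂ b eq)
    ... | no _ with opp D₂ b ≟ opp D₂ b
    ...   | yes _ = refl
    ...   | no ne = ⊥-elim (ne refl)
    reconnect-involutive (inj₁ d) | no d≢a with d ≟ opp D₁ a
    reconnect-involutive (inj₁ d) | no d≢a | yes refl with b ≟ b
    ... | yes _ = refl
    ... | no ne = ⊥-elim (ne refl)
    reconnect-involutive (inj₁ d) | no d≢a | no d≢a′ with opp D₁ d ≟ a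
    ... | yes eq = ⊥-elim (d≢a′ (opp-flip D₁ eq))
    ... | no _ with opp D₁ d ≟ opp D₁ a
    ...   | yes eq = ⊥-elim (d≢a (opp-injective D₁ eq))
    ...   | no _ = cong inj₁ (opp-involutive D₁ d)
    reconnect-involutive (inj₂ e) with e ≟ b
    reconnect-involutive (inj₂ e) | yes refl with opp D₁ a ≟ a
    ... | yes eq = ⊥-elim (opp-fixfree D₁ a eq)
    ... | no _ with opp D₁ a ≟ opp D₁ a
    ...   | yes _ = refl
    ...   | no ne = ⊥-elim (ne refl)
    reconnect-involutive (inj₂ e) | no e≢b with e ≟ opp D₂ b
    reconnect-involutive (inj₂ e) | no e≢b | yes refl with a ≟ a
    ... | yes _ = refl
    ... | no ne = ⊥-elim (ne refl)
    reconnect-involutive (inj₂ e) | no e≢b | no e≢b′ with opp D₂ e ≟ b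
    ... | yes eq = ⊥-elim (e≢b′ (opp-flip D₂ eq))
    ... | no _ with opp D₂ e ≟ opp D₂ b
    ...   | yes eq = ⊥-elim (e≢b (opp-injective D₂ eq))
    ...   | no _ = cong inj₂ (opp-involutive D₂ e)

    reconnect-fixfree : ∀ x → reconnect x ≢ x
    reconnect-fixfree (inj₁ d) with d ≟ a
    ... | yes _ = λ ()
    ... | no _ with d ≟ opp D₁ a
    ...   | yes _ = λ ()
    ...   | no _ = opp-fixfree D₁ d ∘ inj₁-injective
    reconnect-fixfree (inj₂ e) with e ≟ b
    ... | yes _ = λ ()
    ... | no _ with e ≟ opp D₂ b
    ...   | yes _ = λ ()
    ...   | no _ = opp-fixfree D₂ e ∘ inj₂-injective

    connectSum : Diagram
    connectSum = record
      { crossings      = n₁ + n₂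
      ; marks          = j₁ + j₂
      ; opp            = join ∘ reconnect ∘ split
      ; opp-involutive = λ d →
          trans (cong (join ∘ reconnect) (split-join (reconnect (split d))))
            (trans (cong join (reconnect-involutive (split d))) (join-split d))
      ; opp-fixfree    = λ d eq → reconnect-fixfree (split d)
          (trans (sym (split-join (reconnect (split d)))) (cong split eq))
      }

-- A smoothing joins either the two black or the two white regions at its
-- crossing.  If a final diagram is connected, the black regions have been joined
-- along a tree, and so have the white ones; hence the number of black smoothings
-- is one less than the number of black regions, whatever the play.  Therefore L
-- wins if L moves first in a summand with an odd number of crossings, using one
-- colour throughout: L makes more than half of the moves there, which is too
-- many for one of the colours.  It follows that P-positions have an even and
-- N-positions an odd number of crossings.  The remaining cases are won by
-- replying in the summand in which the opponent has just moved; for K one needs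
-- that the connect sum of two connected final diagrams is connected.
module Submission where

open import Defs
open import Data.Bool.Base using (Bool; true; false; not; if_then_else_)
open import Data.Bool.Properties using (not-injective; not-involutive; ¬-not; not-¬)
  renaming (_≟_ to _≟B_)
open import Data.Empty using (⊥; ⊥-elim)
open import Data.Fin.Base using (Fin; zero; suc; toℕ; splitAt; _↑ˡ_; _↑ʳ_)
open import Data.Fin.Patterns using (0F; 1F; 2F; 3F)
open import Data.Fin.Properties
  using (all?; any?; pigeonhole; suc-injective; splitAt⁻¹-↑ˡ; splitAt⁻¹-↑ʳ; +↔⊎; *↔×)
  renaming (_≟_ to _≟F_)
open import Data.Fin.Subset.Properties using (anySubset?)
open import Data.List.Base as List using (List; []; _∷_; length; filter; allFin)
open import Data.List.Membership.Propositional using (_∈_)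
open import Data.List.Membership.Propositional.Properties using (∈-filter⁺; ∈-filter⁻; ∈-allFin)
open import Data.List.Properties using (filter-all; length-tabulate)
import Data.List.Relation.Unary.All as All
open import Data.List.Relation.Unary.AllPairs using ([]; _∷_)
open import Data.List.Relation.Unary.All using ([]; _∷_)
open import Data.List.Relation.Unary.Any using (here; there; index)
open import Data.List.Relation.Unary.Any.Properties using (lookup-index)
open import Data.List.Relation.Unary.Unique.Propositional using (Unique)
open import Data.List.Relation.Unary.Unique.Propositional.Properties using (filter⁺; allFin⁺)
open import Data.Maybe.Base using (Maybe; just; nothing; fromMaybe)
open import Data.Nat.Base
  using (ℕ; zero; suc; pred; _+_; _*_; _≤_; _<_; z≤n; s≤s; s≤s⁻¹; parity)
open import Data.Nat.Properties
  using (≤-reflexive; ≤-refl; ≤-trans; ≤-antisym; <-cmp; <-irrefl; <-≤-trans; <⇒≤; n<1+n; m≤m+n;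
         m≤n⇒∃[o]m+o≡n; +-comm; +-assoc; +-suc; +-identityʳ; +-cancelʳ-≡; +-cancelʳ-≤; +-cancelˡ-<;
         +-monoʳ-≤; +-monoˡ-<; +-0-commutativeMonoid; module ≤-Reasoning)
open import Data.Parity.Base as ℙ using (0ℙ; 1ℙ)
open import Data.Parity.Properties using (+-homo-+; p+p≡0ℙ; suc-homo-⁻¹)
  renaming (+-identityʳ to ℙ-identityʳ)
open import Data.Product.Base using (∃; _×_; _,_; proj₁; proj₂) renaming (map to ×-map)
open import Data.Sum.Base using (_⊎_; inj₁; inj₂; swap)
open import Data.Sum.Function.Propositional using (_⊎-↔_)
open import Data.Vec.Base using (Vec; []; _∷_; _++_; lookup; replicate; tabulate; _[_]≔_)
open import Data.Vec.Properties
  using (lookup∘update; lookup∘update′; lookup∘tabulate; tabulate∘lookup; tabulate-cong;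
         lookup-++ˡ; lookup-++ʳ; []≔-++-↑ˡ; []≔-++-↑ʳ)
open import Function.Base using (_∘_; id)
open import Function.Bundles using (_↔_; Equivalence; Inverse)
open import Function.Properties.Inverse using (↔-trans)
open import Relation.Binary.Construct.Closure.Equivalence as Eq using (EqClosure)
import Relation.Binary.Construct.On as On
open import Relation.Binary.Definitions using (DecidableEquality; tri<; tri≈; tri>)
open import Relation.Binary.PropositionalEquality
  using (_≡_; _≢_; refl; sym; trans; cong; cong₂; subst; subst₂; isEquivalence; module ≡-Reasoning)
open import Relation.Binary.Structures using (IsEquivalence)
open import Relation.Nullary using (¬_; Dec; yes; no; does; contradiction)
open import Relation.Nullary.Decidable using (¬?; map′; _×-dec_)
open import Algebra.Properties.CommutativeMonoid.Sum +-0-commutativeMonoid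
  using (sum; sum-cong-≗; ∑-distrib-+; sum-replicate-zero)

open Game using (Position; Remaining; Final; Connected; start)

-- Planarity enters only through the number `2 + n` of regions, where `n` is the number of
-- crossings; no separation theorem for curves is available. Each smoothing merges two regions, so
-- at least two classes remain at the end, while a single loop has only two sides. Hence a connected
-- final position yields a checkerboard colouring by itself.
--
-- Which colour `L` should use depends on the position. Counting a free crossing once and a crossing
-- smoothed in the colour twice, all connected final positions have the even value `rank + rank` for
-- black. An odd number of free crossings makes the present value odd, so it misses this target, and
-- `L` adds to the colour in excess. The lead is untouched by moves in the other summand, so it does
-- not matter who moves there, or when.

Linked : ∀ {A : Set} {m} → (Fin m → A × A) → A → A → Set
Linked edge = EqClosure (λ x y → ∃ λ i → edge i ≡ (x , y))

-- Vertices and edges of a connected graph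

module _ {A : Set} (_≟A_ : DecidableEquality A) where

  length-filter-≢ : ∀ v {vs} → Unique vs → length vs ≤ suc (length (filter (λ x → ¬? (x ≟A v)) vs))
  length-filter-≢ v [] = z≤n
  length-filter-≢ v {x ∷ vs} (x∉vs ∷ unique) with x ≟A v
  ... | yes refl = ≤-reflexive (cong (suc ∘ length)
    (sym (filter-all (λ x → ¬? (x ≟A v)) (All.map (_∘ sym) x∉vs))))
  ... | no _ = s≤s (length-filter-≢ v unique)

  private
    collapse : A → A → A → A
    collapse u v w = if does (w ≟A v) then u else w

    collapse-≡ : ∀ u v → collapse u v v ≡ u
    collapse-≡ u v with v ≟A v
    ... | yes _ = refl
    ... | no v≢v = contradiction refl v≢v

    collapse-fixes : ∀ u v {w} → w ≢ v → collapse u v w ≡ w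
    collapse-fixes u v {w} w≢v with w ≟A v
    ... | yes w≡v = contradiction w≡v w≢v
    ... | no _ = refl

    collapse-end : ∀ u v → collapse u v u ≡ u
    collapse-end u v with u ≟A v
    ... | yes _ = refl
    ... | no _ = refl

  -- Contract the first edge: this loses one edge and at most one vertex.
  length≤1+edges : ∀ {m} (edge : Fin m → A × A) {vs} → Unique vs →
    (∀ {x y} → x ∈ vs → y ∈ vs → Linked edge x y) → length vs ≤ suc m
  length≤1+edges {zero} edge {[]} _ _ = z≤n
  length≤1+edges {zero} edge {x ∷ []} _ _ = ≤-refl
  length≤1+edges {zero} edge {x ∷ y ∷ vs} ((x≢y ∷ _) ∷ _) linked =
    contradiction (Eq.fold isEquivalence (λ ()) (linked (here refl) (there (here refl)))) x≢y
  length≤1+edges {suc m} edge {vs} unique linked =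
    ≤-trans (length-filter-≢ v unique) (s≤s (length≤1+edges contracted (filter⁺ keep? unique) linked′))
    where
    u = proj₁ (edge zero)
    v = proj₂ (edge zero)
    κ = collapse u v
    keep? = λ x → ¬? (x ≟A v)
    contracted : Fin m → A × A
    contracted i = ×-map κ κ (edge (suc i))
    contract : ∀ {x y} → (∃ λ i → edge i ≡ (x , y)) → Linked contracted (κ x) (κ y)
    contract (zero , refl) =
      subst (Linked contracted (κ u)) (trans (collapse-end u v) (sym (collapse-≡ u v)))
        (Eq.reflexive _)
    contract (suc i , eq) = Eq.return (i , cong (×-map κ κ) eq)
    linked′ : ∀ {x y} → x ∈ filter keep? vs → y ∈ filter keep? vs → Linked contracted x y
    linked′ x∈ y∈ with ∈-filter⁻ keep? x∈ | ∈-filter⁻ keep? y∈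
    ... | x∈vs , x≢v | y∈vs , y≢v =
      subst₂ (Linked contracted) (collapse-fixes u v x≢v) (collapse-fixes u v y≢v)
        (Eq.gfold (Eq.isEquivalence _) κ contract (linked x∈vs y∈vs))

-- Sums over the crossings of a position

State : Set
State = Maybe Smoothing

-- Both sides are the sum of the common terms plus `f i` and `g i`; the additive form avoids
-- truncated subtraction.
sum-update : ∀ {n} {f g : Fin n → ℕ} i → (∀ j → j ≢ i → f j ≡ g j) → sum f + g i ≡ sum g + f i
sum-update {suc n} {f} {g} zero agree = begin
  f zero + sum (f ∘ suc) + g zero   ≡⟨ cong (λ s → f zero + s + g zero)
    (sum-cong-≗ (λ j → agree (suc j) (λ ()))) ⟩
  f zero + sum (g ∘ suc) + g zero   ≡⟨ +-comm _ (g zero) ⟩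
  g zero + (f zero + sum (g ∘ suc)) ≡⟨ cong (g zero +_) (+-comm (f zero) _) ⟩
  g zero + (sum (g ∘ suc) + f zero) ≡⟨ +-assoc (g zero) _ _ ⟨
  g zero + sum (g ∘ suc) + f zero   ∎
  where open ≡-Reasoning
sum-update {suc n} {f} {g} (suc i) agree = begin
  f zero + sum (f ∘ suc) + g (suc i)   ≡⟨ +-assoc (f zero) _ _ ⟩
  f zero + (sum (f ∘ suc) + g (suc i)) ≡⟨ cong₂ _+_ (agree zero (λ ()))
    (sum-update i (λ j j≢i → agree (suc j) (j≢i ∘ suc-injective))) ⟩
  g zero + (sum (g ∘ suc) + f (suc i)) ≡⟨ +-assoc (g zero) _ _ ⟨
  g zero + sum (g ∘ suc) + f (suc i)   ∎
  where open ≡-Reasoning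

weigh : ∀ {n} → (Fin n → State → ℕ) → Vec State n → ℕ
weigh weight p = sum (λ c → weight c (lookup p c))

weigh-update : ∀ {n} (weight : Fin n → State → ℕ) p c x {y} → lookup p c ≡ y →
  weigh weight (p [ c ]≔ x) + weight c y ≡ weigh weight p + weight c x
weigh-update weight p c x refl = trans
  (sum-update c (λ d d≢c → cong (weight d) (lookup∘update′ d≢c p x)))
  (cong (λ y → weigh weight p + weight c y) (lookup∘update c p x))

vacant : State → ℕ
vacant nothing  = 1
vacant (just _) = 0

remaining : ∀ {n} → Vec State n → ℕ
remaining = weigh (λ _ → vacant)

remaining-move : ∀ {n} (p : Vec State n) c s → lookup p c ≡ nothing →
  remaining p ≡ suc (remaining (p [ c ]≔ just s))
remaining-move p c s free = begin
  remaining p                        ≡⟨ +-identityʳ _ ⟨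
  remaining p + 0                    ≡⟨ weigh-update (λ _ → vacant) p c (just s) free ⟨
  remaining (p [ c ]≔ just s) + 1    ≡⟨ +-comm _ 1 ⟩
  suc (remaining (p [ c ]≔ just s))  ∎
  where open ≡-Reasoning

remaining-move⁻ : ∀ {n k} (p : Vec State n) c s → lookup p c ≡ nothing →
  remaining p ≡ suc k → remaining (p [ c ]≔ just s) ≡ k
remaining-move⁻ p c s free eq = cong pred (trans (sym (remaining-move p c s free)) eq)

parity-move : ∀ {n} (p : Vec State n) c s → lookup p c ≡ nothing →
  parity (remaining (p [ c ]≔ just s)) ≡ parity (remaining p) ℙ.⁻¹
parity-move p c s free = begin
  parity r                   ≡⟨ suc-homo-⁻¹ r ⟨
  parity (suc r) ℙ.⁻¹        ≡⟨ cong (λ k → parity k ℙ.⁻¹) (remaining-move p c s free) ⟨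
  parity (remaining p) ℙ.⁻¹  ∎
  where
  open ≡-Reasoning
  r = remaining (p [ c ]≔ just s)

Exhausted : ∀ {n} → Vec State n → Set
Exhausted p = ∀ c → lookup p c ≢ nothing

vacant? : (x : State) → Dec (x ≡ nothing)
vacant? nothing  = yes refl
vacant? (just _) = no λ ()

vacancy? : ∀ {n} (p : Vec State n) → Dec (∃ λ c → lookup p c ≡ nothing)
vacancy? p = any? (λ c → vacant? (lookup p c))

exhausted⇒remaining≡0 : ∀ {n} (p : Vec State n) → Exhausted p → remaining p ≡ 0
exhausted⇒remaining≡0 {n} p full = trans (sum-cong-≗ no-vacancy) (sum-replicate-zero n)
  where
  no-vacancy : ∀ c → vacant (lookup p c) ≡ 0
  no-vacancy c with lookup p c in eq
  ... | nothing = contradiction eq (full c)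
  ... | just _  = refl

remaining≡0⇒exhausted : ∀ {n} (p : Vec State n) → remaining p ≡ 0 → Exhausted p
remaining≡0⇒exhausted p eq c free with () ← trans (sym eq) (remaining-move p c vertical free)

remaining>0⇒vacancy : ∀ {n k} (p : Vec State n) → remaining p ≡ suc k → ∃ λ c → lookup p c ≡ nothing
remaining>0⇒vacancy p eq with vacancy? p
... | yes found = found
... | no none with () ← trans (sym eq) (exhausted⇒remaining≡0 p (λ c free → none (c , free)))

remaining-replicate : ∀ n → remaining (replicate n nothing) ≡ n
remaining-replicate zero    = refl
remaining-replicate (suc n) = cong suc (remaining-replicate n)

-- Strategies, and positions lost for `K`

opponent-≢ : ∀ X → opponent X ≢ X
opponent-≢ K ()
opponent-≢ L ()

-- Played against each other, the two strategies end in a final position that is both connected and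
-- disconnected.
one-winner : ∀ {D Y p} → CanWin D K Y p → CanWin D L Y p → ⊥
one-winner (over _ connected) (over _ disconnected) = disconnected connected
one-winner (over full _) (move c free _ _) = full c free
one-winner (over full _) (reply _ playable _) = playable full
one-winner (move c free _ _) (over full _) = full c free
one-winner (move c free s won) (reply _ _ answers) = one-winner won (answers c free s)
one-winner (reply _ playable _) (over full _) = playable full
one-winner (reply _ _ answers) (move c free s won) = one-winner (answers c free s) won
one-winner {Y = K} (reply K≢K _ _) (reply _ _ _) = K≢K refl
one-winner {Y = L} (reply _ _ _) (reply L≢L _ _) = L≢L refl

exhausted-extension : ∀ {n} (p q : Vec State n) → Exhausted p →
  (∀ c s → lookup p c ≡ just s → lookup q c ≡ just s) → q ≡ p
exhausted-extension p q full extends = begin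
  q                    ≡⟨ tabulate∘lookup q ⟨
  tabulate (lookup q)  ≡⟨ tabulate-cong agree ⟩
  tabulate (lookup p)  ≡⟨ tabulate∘lookup p ⟩
  p                    ∎
  where
  open ≡-Reasoning
  agree : ∀ c → lookup q c ≡ lookup p c
  agree c with lookup p c in eq
  ... | nothing = contradiction eq (full c)
  ... | just s  = extends c s eq

-- A win counts only in a final position, so a game that `L` has already decided must still be
-- played out. This is the invariant for that phase: it survives every further move.
Doomed : (D : Diagram) → Position D → Set
Doomed D p = ∀ q → Final D q → (∀ c s → lookup p c ≡ just s → lookup q c ≡ just s) → ¬ Connected D q

doomed-move : ∀ D p {c s} → Remaining D p c → Doomed D p → Doomed D (p [ c ]≔ just s)
doomed-move D p {c} {s} free doomed q full extends = doomed q full λ d t eq →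
  extends d t (trans (lookup∘update′ (λ { refl → contradiction (trans (sym free) eq) λ () }) p (just s)) eq)

-- Counting smoothings by colour

hit : (Smoothing → Bool) → State → ℕ
hit marked nothing  = 0
hit marked (just s) = if marked s then 1 else 0

hits : ∀ {n} → (Fin n → Smoothing → Bool) → Vec State n → ℕ
hits paint = weigh (λ c → hit (paint c))

-- `paint c s` says whether the smoothing s joins the black (rather than the
-- white) regions at c: it contracts the edge c of the black graph.  The rank
-- is then the number of edges of a spanning tree.
record Tait (D : Diagram) : Set where
  field
    paint        : Fin (crossings D) → Smoothing → Bool
    paint-flip   : ∀ c → paint c vertical ≡ not (paint c horizontal)
    rank         : ℕ
    rank-correct : ∀ q → Final D q → Connected D q → hits paint q ≡ rank

-- Twice the number of x-painted crossings if the free ones are shared equally.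
credit : Bool → (Smoothing → Bool) → State → ℕ
credit x marked nothing  = 1
credit x marked (just s) = if does (marked s ≟B x) then 2 else 0

potential : ∀ {n} → Bool → (Fin n → Smoothing → Bool) → Vec State n → ℕ
potential x paint = weigh (λ c → credit x (paint c))

-- Shows that the potential has the parity of the number of free crossings.
potential-true : ∀ {n} (paint : Fin n → Smoothing → Bool) p →
  potential true paint p ≡ remaining p + (hits paint p + hits paint p)
potential-true paint p = trans (sum-cong-≗ pointwise) (trans
  (∑-distrib-+ (λ c → vacant (lookup p c)) (λ c → h c + h c))
  (cong (remaining p +_) (∑-distrib-+ h h)))
  where
  h = λ c → hit (paint c) (lookup p c)
  pointwise : ∀ c → credit true (paint c) (lookup p c) ≡ vacant (lookup p c) + (h c + h c)
  pointwise c with lookup p c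
  ... | nothing = refl
  ... | just s with paint c s
  ...   | true  = refl
  ...   | false = refl

-- Turns a deficit of black into an excess of white.
potential-sum : ∀ {n} (paint : Fin n → Smoothing → Bool) p →
  potential true paint p + potential false paint p ≡ sum {n} (λ _ → 2)
potential-sum paint p = trans (sym (∑-distrib-+ (φ true) (φ false))) (sum-cong-≗ pointwise)
  where
  φ = λ x c → credit x (paint c) (lookup p c)
  pointwise : ∀ c → φ true c + φ false c ≡ 2
  pointwise c with lookup p c
  ... | nothing = refl
  ... | just s with paint c s
  ...   | true  = refl
  ...   | false = refl

parity-double : ∀ n → parity (n + n) ≡ 0ℙ
parity-double n = trans (+-homo-+ n n) (p+p≡0ℙ (parity n))

final-potential : ∀ {D} (T : Tait D) → let open Tait T in
  ∀ p → Final D p → Connected D p → potential true paint p ≡ rank + rank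
final-potential T p full connected = begin
  potential true paint p                        ≡⟨ potential-true paint p ⟩
  remaining p + (hits paint p + hits paint p)   ≡⟨ cong₂ (λ r h → r + (h + h))
    (exhausted⇒remaining≡0 p full) (rank-correct p full connected) ⟩
  rank + rank                                   ∎
  where
  open Tait T
  open ≡-Reasoning

best : ∀ {n} → (Fin n → Smoothing → Bool) → Bool → Fin n → Smoothing
best paint x c = if does (paint c vertical ≟B x) then vertical else horizontal

-- By `paint-flip` exactly one of the two smoothings has the colour `x`.
best-gain : ∀ {D} (T : Tait D) x c →
  credit x (Tait.paint T c) (just (best (Tait.paint T) x c)) ≡ 2
best-gain T x c with Tait.paint T c vertical in v | Tait.paint T c horizontal in h
  | Tait.paint-flip T c | x
... | false | true  | _ | false rewrite v = refl
... | false | true  | _ | true  rewrite h = refl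
... | true  | false | _ | false rewrite h = refl
... | true  | false | _ | true  rewrite v = refl

-- E consists of A and m further crossings, which need not form a diagram, so
-- that a diagram is also a summand of itself with m = 0.
record Summand (A : Diagram) (m : ℕ) (E : Diagram) : Set where
  field
    combine        : Position A → Vec State m → Position E
    inside         : Fin (crossings A) → Fin (crossings E)
    outside        : Fin m → Fin (crossings E)
    cover          : ∀ c → (∃ λ d → inside d ≡ c) ⊎ (∃ λ d → outside d ≡ c)
    lookup-inside  : ∀ p q c → lookup (combine p q) (inside c) ≡ lookup p c
    lookup-outside : ∀ p q c → lookup (combine p q) (outside c) ≡ lookup q c
    update-inside  : ∀ p q c x → combine p q [ inside c ]≔ x ≡ combine (p [ c ]≔ x) q
    update-outside : ∀ p q c x → combine p q [ outside c ]≔ x ≡ combine p (q [ c ]≔ x)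
    restrict       : ∀ p q → Connected E (combine p q) → Connected A p

-- Strategies of `L` in one summand

module _ {A : Diagram} {m : ℕ} {E : Diagram} (S : Summand A m E) where
  open Summand S

  final-inside : ∀ p q → Final E (combine p q) → Final A p
  final-inside p q full c free = full (inside c) (trans (lookup-inside p q c) free)

  move-inside : ∀ X p q c → Remaining A p c → ∀ s →
    CanWin E X (opponent X) (combine (p [ c ]≔ just s) q) → CanWin E X X (combine p q)
  move-inside X p q c free s won = move (inside c) (trans (lookup-inside p q c) free) s
    (subst (CanWin E X (opponent X)) (sym (update-inside p q c (just s))) won)

  move-outside : ∀ X p q c → lookup q c ≡ nothing → ∀ s →
    CanWin E X (opponent X) (combine p (q [ c ]≔ just s)) → CanWin E X X (combine p q)
  move-outside X p q c free s won = move (outside c) (trans (lookup-outside p q c) free) s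
    (subst (CanWin E X (opponent X)) (sym (update-outside p q c (just s))) won)

  answer : ∀ X p q → ¬ Final E (combine p q) →
    (∀ c → Remaining A p c → ∀ s → CanWin E X X (combine (p [ c ]≔ just s) q)) →
    (∀ c → lookup q c ≡ nothing → ∀ s → CanWin E X X (combine p (q [ c ]≔ just s))) →
    CanWin E X (opponent X) (combine p q)
  answer X p q playable inner outer = reply (opponent-≢ X) playable respond
    where
    respond : ∀ c → Remaining E (combine p q) c → ∀ s → CanWin E X X (combine p q [ c ]≔ just s)
    respond c free s with cover c
    ... | inj₁ (d , refl) = subst (CanWin E X X) (sym (update-inside p q d (just s)))
      (inner d (trans (sym (lookup-inside p q d)) free) s)
    ... | inj₂ (d , refl) = subst (CanWin E X X) (sym (update-outside p q d (just s)))
      (outer d (trans (sym (lookup-outside p q d)) free) s)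

  playable-total : ∀ p q {k} → remaining (combine p q) ≡ suc k → ¬ Final E (combine p q)
  playable-total p q eq full with remaining>0⇒vacancy (combine p q) eq
  ... | c , free = full c free

  remaining-inside : ∀ p q {k} → remaining (combine p q) ≡ suc k → ∀ c → Remaining A p c → ∀ s →
    remaining (combine (p [ c ]≔ just s) q) ≡ k
  remaining-inside p q eq c free s = trans (cong remaining (sym (update-inside p q c (just s))))
    (remaining-move⁻ (combine p q) (inside c) s (trans (lookup-inside p q c) free) eq)

  remaining-outside : ∀ p q {k} → remaining (combine p q) ≡ suc k → ∀ c → lookup q c ≡ nothing → ∀ s →
    remaining (combine p (q [ c ]≔ just s)) ≡ k
  remaining-outside p q eq c free s = trans (cong remaining (sym (update-outside p q c (just s))))
    (remaining-move⁻ (combine p q) (outside c) s (trans (lookup-outside p q c) free) eq)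

  -- Any move of `L` will do, since by `restrict` a disconnected `A` disconnects `E`. The number `k`
  -- of free crossings in `E` bounds the rest of the game.
  doomed-wins : ∀ k Y p q → remaining (combine p q) ≡ k → Doomed A p → CanWin E L Y (combine p q)
  doomed-wins zero Y p q eq doomed = over full λ connected →
    doomed p (final-inside p q full) (λ _ _ eq′ → eq′) (restrict p q connected)
    where full = remaining≡0⇒exhausted (combine p q) eq
  doomed-wins (suc k) L p q eq doomed with remaining>0⇒vacancy (combine p q) eq
  ... | c , free with cover c
  ...   | inj₁ (d , refl) = move-inside L p q d free′ vertical
    (doomed-wins k K _ q (remaining-inside p q eq d free′ vertical) (doomed-move A p free′ doomed))
    where free′ = trans (sym (lookup-inside p q d)) free
  ...   | inj₂ (d , refl) = move-outside L p q d free′ vertical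
    (doomed-wins k K p _ (remaining-outside p q eq d free′ vertical) doomed)
    where free′ = trans (sym (lookup-outside p q d)) free
  doomed-wins (suc k) K p q eq doomed = answer L p q (playable-total p q eq)
    (λ c free s → doomed-wins k L _ q (remaining-inside p q eq c free s) (doomed-move A p free doomed))
    (λ c free s → doomed-wins k L p _ (remaining-outside p q eq c free s) doomed)

  -- `L` follows the strategy in `A` and answers every outside move outside, which the even number
  -- of free crossings there makes possible.
  even-elsewhere : ∀ k Y p q → remaining q ≡ k → parity k ≡ 0ℙ →
    CanWin A L Y p → CanWin E L Y (combine p q)
  even-elsewhere k Y p q eq even (over full disconnected) =
    doomed-wins _ Y p q refl λ r _ extends connected →
      disconnected (subst (Connected A) (exhausted-extension p r full extends) connected)
  even-elsewhere k L p q eq even (move c free s won) =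
    move-inside L p q c free s (even-elsewhere k K _ q eq even won)
  even-elsewhere k L p q eq even (reply L≢L _ _) = contradiction refl L≢L
  even-elsewhere k K p q eq even strategy@(reply _ playable answers) =
    answer L p q (λ full → playable (final-inside p q full))
      (λ c free s → even-elsewhere k L _ q eq even (answers c free s))
      (outer k q eq even)
    where
    -- The move of `K` and the reply use up two outside crossings: the strategy in `A` is kept, and
    -- `k` drops by two with its parity unchanged. The case `k = 1` contradicts the parity.
    outer : ∀ k q → remaining q ≡ k → parity k ≡ 0ℙ → ∀ c → lookup q c ≡ nothing → ∀ s →
      CanWin E L L (combine p (q [ c ]≔ just s))
    outer zero q eq _ c free s = contradiction free (remaining≡0⇒exhausted q eq c)
    outer (suc (suc k)) q eq even c free s with remaining>0⇒vacancy q′ eq′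
      where
      q′ = q [ c ]≔ just s
      eq′ = remaining-move⁻ q c s free eq
    ... | d , free′ = move-outside L p q′ d free′ vertical
      (even-elsewhere k K p _ (remaining-move⁻ q′ d vertical free′ eq′) even strategy)
      where
      q′ = q [ c ]≔ just s
      eq′ = remaining-move⁻ q c s free eq

  -- Connected final positions weigh less than `b`, so `L` only has to finish `A` with weight at
  -- least `b`. A move of `K` in `A` costs at most the one unit that the free crossing was worth.
  module _ (weight : Fin (crossings A) → State → ℕ) (best : Fin (crossings A) → Smoothing)
    (gain : ∀ c → weight c (just (best c)) ≡ 2) (unit : ∀ c → weight c nothing ≡ 1)
    (b : ℕ) (bound : ∀ p → Final A p → Connected A p → weigh weight p < b) where

    private
      φ = weigh weight

      gained : ∀ p c → Remaining A p c → φ (p [ c ]≔ just (best c)) ≡ suc (φ p)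
      gained p c free = +-cancelʳ-≡ 1 _ _ (begin
        φ (p [ c ]≔ just (best c)) + 1                ≡⟨ cong (φ (p [ c ]≔ just (best c)) +_) (unit c) ⟨
        φ (p [ c ]≔ just (best c)) + weight c nothing ≡⟨ weigh-update weight p c _ free ⟩
        φ p + weight c (just (best c))                ≡⟨ cong (φ p +_) (gain c) ⟩
        φ p + 2                                       ≡⟨ +-suc (φ p) 1 ⟩
        suc (φ p) + 1                                 ∎)
        where open ≡-Reasoning

      lost : ∀ p c s → Remaining A p c → b < φ p → b ≤ φ (p [ c ]≔ just s)
      lost p c s free b<φ = s≤s⁻¹ (begin
        suc b                               ≤⟨ b<φ ⟩
        φ p                                 ≤⟨ m≤m+n _ _ ⟩
        φ p + weight c (just s)             ≡⟨ weigh-update weight p c _ free ⟨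
        φ p′ + weight c nothing             ≡⟨ cong (φ p′ +_) (unit c) ⟩
        φ p′ + 1                            ≡⟨ +-comm (φ p′) 1 ⟩
        suc (φ p′)                          ∎)
        where
        open ≤-Reasoning
        p′ = p [ c ]≔ just s

      full⇒doomed : ∀ p → Final A p → b ≤ φ p → Doomed A p
      full⇒doomed p full b≤φ q q-full extends connected = <-irrefl refl (<-≤-trans
        (bound p full (subst (Connected A) (exhausted-extension p q full extends) connected)) b≤φ)

    -- L replies to a loss of at most one by a gain of one as long as A has a
    -- free crossing.
    greedy : ∀ k p q → remaining (combine p q) ≡ k → b ≤ φ p → CanWin E L L (combine p q)
    greedy-reply : ∀ k p q → remaining (combine p q) ≡ k → b < φ p → CanWin E L K (combine p q)

    greedy k p q eq b≤φ with vacancy? p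
    ... | no none = doomed-wins k L p q eq (full⇒doomed p (λ c free → none (c , free)) b≤φ)
    greedy zero p q eq b≤φ | yes (c , free) = contradiction free
      (final-inside p q (remaining≡0⇒exhausted (combine p q) eq) c)
    greedy (suc k) p q eq b≤φ | yes (c , free) = move-inside L p q c free (best c)
      (greedy-reply k _ q (remaining-inside p q eq c free (best c))
        (subst (b <_) (sym (gained p c free)) (s≤s b≤φ)))

    greedy-reply zero p q eq b<φ = doomed-wins zero K p q eq
      (full⇒doomed p (final-inside p q (remaining≡0⇒exhausted (combine p q) eq)) (<⇒≤ b<φ))
    greedy-reply (suc k) p q eq b<φ = answer L p q (playable-total p q eq)
      (λ c free s → greedy k _ q (remaining-inside p q eq c free s) (lost p c s free b<φ))
      (λ c free s → greedy k p _ (remaining-outside p q eq c free s) (<⇒≤ b<φ))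

  -- The black potential of `p` is odd and the value `rank + rank` of connected final positions is
  -- even. They differ, and the sign of the difference tells `L` which colour to use.
  odd-wins : Tait A → ∀ p q → parity (remaining p) ≡ 1ℙ → CanWin E L L (combine p q)
  odd-wins T p q odd with <-cmp (φ true p) (rank + rank)
    where
    open Tait T
    φ = λ x → potential x paint
  ... | tri≈ _ eq _ = contradiction (trans (sym odd) even) λ ()
    where
    open Tait T
    h = hits paint p
    even : parity (remaining p) ≡ 0ℙ
    even = begin
      parity (remaining p)                  ≡⟨ ℙ-identityʳ _ ⟨
      parity (remaining p) ℙ.+ 0ℙ           ≡⟨ cong (parity (remaining p) ℙ.+_) (parity-double h) ⟨
      parity (remaining p) ℙ.+ parity (h + h) ≡⟨ +-homo-+ (remaining p) _ ⟨
      parity (remaining p + (h + h))        ≡⟨ cong parity (potential-true paint p) ⟨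
      parity (potential true paint p)       ≡⟨ cong parity eq ⟩
      parity (rank + rank)                  ≡⟨ parity-double rank ⟩
      0ℙ                                    ∎
      where open ≡-Reasoning
  -- The threshold is the present potential itself: having the move, `L` needs no margin.
  ... | tri> _ _ low = greedy (credit true ∘ paint) (best paint true)
    (best-gain T true) (λ _ → refl) _ bound _ p q refl ≤-refl
    where
    open Tait T
    bound : ∀ r → Final A r → Connected A r → potential true paint r < potential true paint p
    bound r full connected =
      subst (_< potential true paint p) (sym (final-potential T r full connected)) low
  ... | tri< high _ _ = greedy (credit false ∘ paint) (best paint false)
    (best-gain T false) (λ _ → refl) _ bound _ p q refl ≤-refl
    where
    open Tait T
    φ = λ x → potential x paint
    bound : ∀ r → Final A r → Connected A r → φ false r < φ false p
    bound r full connected = +-cancelˡ-< (φ true p) (φ false r) (φ false p) (begin-strict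
      φ true p + φ false r     <⟨ +-monoˡ-< (φ false r) high ⟩
      rank + rank + φ false r  ≡⟨ cong (_+ φ false r) (final-potential T r full connected) ⟨
      φ true r + φ false r     ≡⟨ potential-sum paint r ⟩
      sum {crossings A} (λ _ → 2) ≡⟨ potential-sum paint p ⟨
      φ true p + φ false p     ∎)
      where open ≤-Reasoning

-- Final positions as curves

-- At a free crossing the value is junk (the identity).
strand : ∀ D → Position D → Half D → Half D
strand D p (inj₁ (c , i)) with lookup p c
... | just s  = inj₁ (c , partner s i)
... | nothing = inj₁ (c , i)
strand D p (inj₂ (q , i)) = inj₂ (q , rotate₂ i)

partner-involutive : ∀ s i → partner s (partner s i) ≡ i
partner-involutive horizontal 0F = refl
partner-involutive horizontal 1F = refl
partner-involutive horizontal 2F = refl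
partner-involutive horizontal 3F = refl
partner-involutive vertical 0F = refl
partner-involutive vertical 1F = refl
partner-involutive vertical 2F = refl
partner-involutive vertical 3F = refl

strand-smoothed : ∀ D p c {s} i → lookup p c ≡ just s →
  strand D p (inj₁ (c , i)) ≡ inj₁ (c , partner s i)
strand-smoothed D p c i eq with lookup p c
strand-smoothed D p c i refl | just s = refl

strand-involutive : ∀ D p d → strand D p (strand D p d) ≡ d
strand-involutive D p (inj₁ (c , i)) with lookup p c in eq
... | just s  = trans (strand-smoothed D p c (partner s i) eq)
  (cong (λ k → inj₁ (c , k)) (partner-involutive s i))
... | nothing rewrite eq = refl
strand-involutive D p (inj₂ (q , 0F)) = refl
strand-involutive D p (inj₂ (q , 1F)) = refl

joined-cases : ∀ D p → Final D p → ∀ {d e} → Game.Joined D p d e →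
  e ≡ d ⊎ e ≡ opp D d ⊎ e ≡ strand D p d
joined-cases D p full (Game.arc d) = inj₂ (inj₁ refl)
joined-cases D p full (Game.mark q 0F 0F) = inj₁ refl
joined-cases D p full (Game.mark q 0F 1F) = inj₂ (inj₂ refl)
joined-cases D p full (Game.mark q 1F 0F) = inj₂ (inj₂ refl)
joined-cases D p full (Game.mark q 1F 1F) = inj₁ refl
joined-cases D p full (Game.precrossing c free _ _) = contradiction free (full c)
joined-cases D p full (Game.smoothed c s eq i) = inj₂ (inj₂ (sym (strand-smoothed D p c i eq)))

length-filter-allFin : ∀ {n} {P : Fin n → Set} (P? : ∀ i → Dec (P i)) →
  length (filter P? (allFin n)) ≡ sum (λ i → if does (P? i) then 1 else 0)
length-filter-allFin {P = P} P? = go id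
  where
  go : ∀ {m} (f : Fin m → _) →
    length (filter P? (List.tabulate f)) ≡ sum (λ i → if does (P? (f i)) then 1 else 0)
  go {zero} f = refl
  go {suc m} f with P? (f zero)
  ... | yes _ = cong suc (go (f ∘ suc))
  ... | no _  = go (f ∘ suc)

-- Regions, checkerboard colourings and the rank

module Checkerboard (S : Shadow) where
  D = diagram S
  n = crossings D

  R : Half D → Fin (2 + n)
  R = region S

  corner-region : ∀ d → R d ≡ R (opp D (rotate d))
  corner-region d = Equivalence.from (region-correct S _ _) (Eq.return (corner d))

  -- The regions to the left of the half-edges 0, 1, 2, 3 are those to the north, west, south and
  -- east. The horizontal smoothing separates north from south and merges west with east.
  merged : Smoothing → Fin n → Fin (2 + n) × Fin (2 + n)
  merged horizontal c = R (inj₁ (c , 1F)) , R (inj₁ (c , 3F))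
  merged vertical   c = R (inj₁ (c , 0F)) , R (inj₁ (c , 2F))

  -- `vertical` is a junk value at the crossings that are still free.
  merger : Position D → Fin n → Fin (2 + n) × Fin (2 + n)
  merger p c = merged (fromMaybe vertical (lookup p c)) c

  merger-smoothed : ∀ p c {s} → lookup p c ≡ just s → merger p c ≡ merged s c
  merger-smoothed p c eq rewrite eq = refl

  Crosses : Position D → Fin (2 + n) → Fin (2 + n) → Set
  Crosses p r t = r ≡ t ⊎ (∃ λ c → merger p c ≡ (r , t) ⊎ merger p c ≡ (t , r))

  -- Let the curve enter by `strand D p d` and leave by `d`; the two regions are those on its left
  -- before and after. On the inside of the turn they share a corner, on the outside they are the
  -- two merged regions.
  along-strand : ∀ p → Final D p → ∀ d → Crosses p (R d) (R (opp D (strand D p d)))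
  along-strand p full (inj₂ (q , i)) = inj₁ (corner-region _)
  along-strand p full (inj₁ (c , i)) with lookup p c in eq
  ... | nothing = contradiction eq (full c)
  ... | just horizontal = cases i
    where
    m = merger-smoothed p c eq
    cases : ∀ i → Crosses p (R (inj₁ (c , i))) (R (opp D (inj₁ (c , partner horizontal i))))
    cases 0F = inj₁ (corner-region _)
    cases 1F = inj₂ (c , inj₁ (trans m (cong₂ _,_ refl (corner-region _))))
    cases 2F = inj₁ (corner-region _)
    cases 3F = inj₂ (c , inj₂ (trans m (cong₂ _,_ (corner-region _) refl)))
  ... | just vertical = cases i
    where
    m = merger-smoothed p c eq
    cases : ∀ i → Crosses p (R (inj₁ (c , i))) (R (opp D (inj₁ (c , partner vertical i))))
    cases 0F = inj₂ (c , inj₁ (trans m (cong₂ _,_ refl (corner-region _))))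
    cases 1F = inj₁ (corner-region _)
    cases 2F = inj₂ (c , inj₂ (trans m (cong₂ _,_ (corner-region _) refl)))
    cases 3F = inj₁ (corner-region _)

  Coloring : (Fin (2 + n) → Bool) → Set
  Coloring χ = ∀ d → χ (R (opp D d)) ≡ not (χ (R d))

  -- n mergers cannot connect all 2 + n regions.  If the two sides of some
  -- half-edge were connected, then following the single loop would connect
  -- everything; hence the two sides of the loop are two classes of regions.
  module _ (p : Position D) (full : Final D p) (connected : Connected D p) where
    private
      _~_ : Fin (2 + n) → Fin (2 + n) → Set
      _~_ = Linked (merger p)

      ~-sym : ∀ {r t} → r ~ t → t ~ r
      ~-sym = Eq.symmetric _
      ~-trans : ∀ {r s t} → r ~ s → s ~ t → r ~ t
      ~-trans = Eq.transitive _

      crosses⇒~ : ∀ {r t} → Crosses p r t → r ~ t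
      crosses⇒~ (inj₁ refl) = Eq.reflexive _
      crosses⇒~ (inj₂ (c , inj₁ eq)) = Eq.return (c , eq)
      crosses⇒~ (inj₂ (c , inj₂ eq)) = ~-sym (Eq.return (c , eq))

      -- The pair of sides is unordered, because passing from a half-edge to the other half of its
      -- arc exchanges left and right.
      SameSides : Half D → Half D → Set
      SameSides d e =
        (R d ~ R e × R (opp D d) ~ R (opp D e)) ⊎ (R d ~ R (opp D e) × R (opp D d) ~ R e)

      sameSides-isEquivalence : IsEquivalence SameSides
      sameSides-isEquivalence = record
        { refl  = inj₁ (Eq.reflexive _ , Eq.reflexive _)
        ; sym   = λ where
            (inj₁ (u , v)) → inj₁ (~-sym u , ~-sym v)
            (inj₂ (u , v)) → inj₂ (~-sym v , ~-sym u)
        ; trans = λ where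
            (inj₁ (u , v)) (inj₁ (u′ , v′)) → inj₁ (~-trans u u′ , ~-trans v v′)
            (inj₁ (u , v)) (inj₂ (u′ , v′)) → inj₂ (~-trans u u′ , ~-trans v v′)
            (inj₂ (u , v)) (inj₁ (u′ , v′)) → inj₂ (~-trans u v′ , ~-trans v u′)
            (inj₂ (u , v)) (inj₂ (u′ , v′)) → inj₁ (~-trans u v′ , ~-trans v u′)
        }

      strand-sides : ∀ d → R (opp D d) ~ R (strand D p d)
      strand-sides d = ~-sym (subst (λ e → R (strand D p d) ~ R (opp D e)) (strand-involutive D p d)
        (crosses⇒~ (along-strand p full (strand D p d))))

      joined⇒sameSides : ∀ {d e} → Game.Joined D p d e → SameSides d e
      joined⇒sameSides {d} joined with joined-cases D p full joined
      ... | inj₁ refl = inj₁ (Eq.reflexive _ , Eq.reflexive _)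
      ... | inj₂ (inj₁ refl) = inj₂
        (subst (λ e → R d ~ R e) (sym (opp-involutive D d)) (Eq.reflexive _) , Eq.reflexive _)
      ... | inj₂ (inj₂ refl) = inj₂ (crosses⇒~ (along-strand p full d) , strand-sides d)

      sameSides : ∀ d e → SameSides d e
      sameSides d e = Eq.fold sameSides-isEquivalence joined⇒sameSides (connected d e)

      two-sided : ∀ d → ¬ (R d ~ R (opp D d))
      two-sided d one-sided = <-irrefl refl (subst (_≤ suc n) (length-tabulate id)
        (length≤1+edges _≟F_ (merger p) (allFin⁺ (2 + n)) λ {r} {t} _ _ → ~-trans (~-sym (all r)) (all t)))
        where
        all : ∀ r → R d ~ r
        all r with region-surjective S r
        ... | e , refl with sameSides d e
        ...   | inj₁ (u , _) = u
        ...   | inj₂ (_ , v) = ~-trans one-sided v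

      base = proj₁ (region-surjective S 0F)

      -- The value is read off from a proof of `sameSides`, that is, from whether the region is
      -- linked to the left or to the right of `base`. By `two-sided` these classes are disjoint, so
      -- the choices made do not matter.
      χ : Fin (2 + n) → Bool
      χ r with sameSides base (proj₁ (region-surjective S r))
      ... | inj₁ _ = true
      ... | inj₂ _ = false

      χ-correct : ∀ r → (χ r ≡ true × R base ~ r) ⊎ (χ r ≡ false × R (opp D base) ~ r)
      χ-correct r with sameSides base (proj₁ (region-surjective S r))
      ... | inj₁ (u , _) = inj₁ (refl , subst (R base ~_) (proj₂ (region-surjective S r)) u)
      ... | inj₂ (_ , v) = inj₂ (refl , subst (R (opp D base) ~_) (proj₂ (region-surjective S r)) v)

    coloring : ∃ Coloring
    coloring = χ , alternates
      where
      alternates : Coloring χ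
      alternates d with χ-correct (R d) | χ-correct (R (opp D d))
      ... | inj₁ (_ , u) | inj₁ (_ , v) = contradiction (~-trans (~-sym u) v) (two-sided d)
      ... | inj₁ (x , _) | inj₂ (y , _) = trans y (cong not (sym x))
      ... | inj₂ (x , _) | inj₁ (y , _) = trans y (cong not (sym x))
      ... | inj₂ (_ , u) | inj₂ (_ , v) = contradiction (~-trans (~-sym u) v) (two-sided d)

  module Colored (χ : Fin (2 + n) → Bool) (alternates : Coloring χ) where
    color : Half D → Bool
    color d = χ (R d)

    -- The corner between the two half-edges is on the left of `d` and on the right of `rotate d`.
    color-rotate : ∀ d → color (rotate d) ≡ not (color d)
    color-rotate d = not-injective (begin
      not (color (rotate d))    ≡⟨ alternates (rotate d) ⟨
      χ (R (opp D (rotate d)))  ≡⟨ cong χ (corner-region d) ⟨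
      color d                   ≡⟨ not-involutive _ ⟨
      not (not (color d))       ∎)
      where open ≡-Reasoning

    color-rotate⁻ : ∀ d → color d ≡ not (color (rotate d))
    color-rotate⁻ d = trans (sym (not-involutive _)) (cong not (sym (color-rotate d)))

    color-strand : ∀ p → Final D p → ∀ d → color (strand D p d) ≡ not (color d)
    color-strand p full (inj₂ (q , i)) = color-rotate (inj₂ (q , i))
    color-strand p full (inj₁ (c , i)) with lookup p c in eq
    ... | nothing = contradiction eq (full c)
    ... | just horizontal = cases i
      where
      cases : ∀ i → color (inj₁ (c , partner horizontal i)) ≡ not (color (inj₁ (c , i)))
      cases 0F = color-rotate _
      cases 1F = color-rotate⁻ _
      cases 2F = color-rotate _
      cases 3F = color-rotate⁻ _
    ... | just vertical = cases i
      where
      cases : ∀ i → color (inj₁ (c , partner vertical i)) ≡ not (color (inj₁ (c , i)))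
      cases 0F = color-rotate⁻ _
      cases 1F = color-rotate _
      cases 2F = color-rotate⁻ _
      cases 3F = color-rotate _

    paint : Fin n → Smoothing → Bool
    paint c s = χ (proj₁ (merged s c))

    count : ∀ {m} → (Fin m → Bool) → Bool → ℕ
    count f x = length (filter (λ i → f i ≟B x) (allFin _))

    count-both : ∀ {m} (f : Fin m → Bool) → count f true + count f false ≡ m
    count-both {m} f = begin
      count f true + count f false  ≡⟨ cong₂ _+_ (length-filter-allFin (λ i → f i ≟B true))
                                               (length-filter-allFin (λ i → f i ≟B false)) ⟩
      sum (is true) + sum (is false) ≡⟨ ∑-distrib-+ (is true) (is false) ⟨
      sum (λ i → is true i + is false i) ≡⟨ sum-cong-≗ one ⟩
      sum {m} (λ _ → 1)  ≡⟨ sum-ones m ⟩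
      m ∎
      where
      open ≡-Reasoning
      is : Bool → Fin m → ℕ
      is x i = if does (f i ≟B x) then 1 else 0
      one : ∀ i → is true i + is false i ≡ 1
      one i with f i
      ... | true  = refl
      ... | false = refl
      sum-ones : ∀ m → sum {m} (λ _ → 1) ≡ m
      sum-ones zero    = refl
      sum-ones (suc m) = cong suc (sum-ones m)

    module _ (p : Position D) (full : Final D p) (connected : Connected D p) where

      hits≡count : hits paint p ≡ count (χ ∘ proj₁ ∘ merger p) true
      hits≡count = sym (trans (length-filter-allFin (λ c → χ (proj₁ (merger p c)) ≟B true))
        (sum-cong-≗ pointwise))
        where
        pointwise : ∀ c → (if does (χ (proj₁ (merger p c)) ≟B true) then 1 else 0)
          ≡ hit (paint c) (lookup p c)
        pointwise c with lookup p c in eq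
        ... | nothing = contradiction eq (full c)
        ... | just s with paint c s
        ...   | true  = refl
        ...   | false = refl

      module _ (x : Bool) where
        private
          kept : List (Fin n)
          kept = filter (λ c → χ (proj₁ (merger p c)) ≟B x) (allFin n)

          edge : Fin (length kept) → Fin (2 + n) × Fin (2 + n)
          edge i = merger p (List.lookup kept i)

          keep : ∀ {r t} c → merger p c ≡ (r , t) → χ r ≡ x → Linked edge r t
          keep c eq r≡x = Eq.return
            (index c∈kept , trans (cong (merger p) (sym (lookup-index c∈kept))) eq)
            where
            c∈kept : c ∈ kept
            c∈kept = ∈-filter⁺ _ (∈-allFin c) (trans (cong (χ ∘ proj₁) eq) r≡x)

          crosses⇒linked : ∀ {r t} → Crosses p r t → χ r ≡ x → χ t ≡ x → Linked edge r t
          crosses⇒linked (inj₁ refl) _ _ = Eq.reflexive _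
          crosses⇒linked (inj₂ (c , inj₁ eq)) r≡x _ = keep c eq r≡x
          crosses⇒linked (inj₂ (c , inj₂ eq)) _ t≡x = Eq.symmetric _ (keep c eq t≡x)

          -- Along the loop, the side of colour `x` changes only where two regions of that colour
          -- are merged.
          side : Half D → Fin (2 + n)
          side d = if does (color d ≟B x) then R d else R (opp D d)

          side-left : ∀ {d} → color d ≡ x → side d ≡ R d
          side-left {d} eq with color d ≟B x
          ... | yes _ = refl
          ... | no ne = contradiction eq ne

          side-right : ∀ {d} → color d ≢ x → side d ≡ R (opp D d)
          side-right {d} ne with color d ≟B x
          ... | yes eq = contradiction eq ne
          ... | no _ = refl

          flipped-≢ : ∀ {b c : Bool} → b ≡ not c → c ≡ x → b ≢ x
          flipped-≢ {c = c} b≡ c≡x b≡x = not-¬ (sym (trans c≡x (trans (sym b≡x) b≡))) refl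

          flipped-≡ : ∀ {b c : Bool} → b ≡ not c → c ≢ x → b ≡ x
          flipped-≡ b≡ c≢x = trans b≡ (sym (¬-not (c≢x ∘ sym)))

          side-opp : ∀ d → side (opp D d) ≡ side d
          side-opp d with color d ≟B x
          ... | yes eq = trans (side-right (flipped-≢ (alternates d) eq)) (cong R (opp-involutive D d))
          ... | no ne  = side-left (flipped-≡ (alternates d) ne)

          side-strand-left : ∀ d → color d ≡ x → Linked edge (side d) (side (strand D p d))
          side-strand-left d eq = subst₂ (Linked edge) (sym (side-left eq)) (sym (side-right other))
            (crosses⇒linked (along-strand p full d) eq (flipped-≡ (alternates (strand D p d)) other))
            where other = flipped-≢ (color-strand p full d) eq

          side-strand : ∀ d → Linked edge (side d) (side (strand D p d))
          side-strand d with color d ≟B x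
          ... | yes eq = subst (λ r → Linked edge r (side (strand D p d))) (side-left eq)
            (side-strand-left d eq)
          -- Colours alternate along a strand, so `strand D p d` has colour `x` on its left and the
          -- other case applies from there.
          ... | no ne = Eq.symmetric _ (subst (Linked edge (side (strand D p d)))
            (trans (cong side (strand-involutive D p d)) (side-right ne))
            (side-strand-left (strand D p d) (flipped-≡ (color-strand p full d) ne)))

          joined⇒linked : ∀ {d e} → Game.Joined D p d e → Linked edge (side d) (side e)
          joined⇒linked {d} joined with joined-cases D p full joined
          ... | inj₁ refl = Eq.reflexive _
          ... | inj₂ (inj₁ refl) = subst (Linked edge (side d)) (sym (side-opp d)) (Eq.reflexive _)
          ... | inj₂ (inj₂ refl) = side-strand d

          region⇒side : ∀ r → χ r ≡ x → ∃ λ d → side d ≡ r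
          region⇒side r r≡x with region-surjective S r
          ... | d , refl = d , side-left r≡x

        -- Following the `x`-coloured side of the loop links all regions of colour `x` by mergers of
        -- that colour, so these form a connected graph.
        regions≤1+mergers : count χ x ≤ suc (count (χ ∘ proj₁ ∘ merger p) x)
        regions≤1+mergers = length≤1+edges _≟F_ edge (filter⁺ has-color? (allFin⁺ (2 + n))) linked
          where
          has-color? = λ r → χ r ≟B x
          linked : ∀ {r t} → r ∈ filter has-color? (allFin _) → t ∈ filter has-color? (allFin _) →
            Linked edge r t
          linked {r} {t} r∈ t∈
            with region⇒side r (proj₂ (∈-filter⁻ has-color? r∈))
               | region⇒side t (proj₂ (∈-filter⁻ has-color? t∈))
          ... | d , refl | e , refl =
            Eq.gfold (Eq.isEquivalence _) side joined⇒linked (connected d e)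

      -- Both bounds are equalities, since they sum to Euler's formula.
      hits≡rank : hits paint p ≡ pred (count χ true)
      hits≡rank = trans hits≡count (cong pred (≤-antisym black (regions≤1+mergers true)))
        where
        b = count (χ ∘ proj₁ ∘ merger p) true
        w = count (χ ∘ proj₁ ∘ merger p) false
        black : suc b ≤ count χ true
        black = +-cancelʳ-≤ (suc w) (suc b) (count χ true) (begin
          suc b + suc w                   ≡⟨ cong suc (+-suc b w) ⟩
          2 + (b + w)                     ≡⟨ cong (2 +_) (count-both (χ ∘ proj₁ ∘ merger p)) ⟩
          2 + n                           ≡⟨ count-both χ ⟨
          count χ true + count χ false    ≤⟨ +-monoʳ-≤ (count χ true) (regions≤1+mergers false) ⟩
          count χ true + suc w            ∎)
          where open ≤-Reasoning

  coloring? : ∀ χ → Dec (Coloring χ)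
  coloring? χ = map′
    (λ { (f , g) (inj₁ (c , i)) → f c i ; (f , g) (inj₂ (q , i)) → g q i })
    (λ f → (λ c i → f (inj₁ (c , i))) , (λ q i → f (inj₂ (q , i))))
    (all? (λ c → all? λ i → alternates? (inj₁ (c , i)))
      ×-dec all? (λ q → all? λ i → alternates? (inj₂ (q , i))))
    where
    alternates? : ∀ d → Dec (χ (R (opp D d)) ≡ not (χ (R d)))
    alternates? d = χ (R (opp D d)) ≟B not (χ (R d))

  -- `paint` and `rank` must serve all final positions at once, whereas `coloring` starts from one
  -- that is connected. So a colouring is searched for among all subsets of the regions; if there is
  -- none, no final position is connected and `rank-correct` is vacuous.
  tait : Tait D
  tait with anySubset? (λ v → coloring? (lookup v))
  ... | yes (v , alternates) = record
    { paint        = paint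
    ; paint-flip   = λ c → color-rotate⁻ (inj₁ (c , 0F))
    ; rank         = pred (count (lookup v) true)
    ; rank-correct = hits≡rank
    }
    where open Colored (lookup v) alternates
  ... | no none = record
    { paint        = λ { c horizontal → true ; c vertical → false }
    ; paint-flip   = λ c → refl
    ; rank         = 0
    ; rank-correct = λ p full connected → let χ , alternates = coloring p full connected in
        contradiction (tabulate χ , λ d → subst₂ (λ x y → x ≡ not y)
          (sym (lookup∘tabulate χ (R (opp D d)))) (sym (lookup∘tabulate χ (R d))) (alternates d)) none
    }

-- Cutting one arc of a loop

enumeration : ∀ n j → Fin (n * 4 + j * 2) ↔ HalfEdge n j
enumeration n j = ↔-trans +↔⊎ (*↔× ⊎-↔ *↔×)

-- Walking along the loop from a, one leaves all vertices by half-edges of the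
-- colour of opp a and hence returns to a without crossing the arc of a before.
module _ (S : Shadow) (p : Position (diagram S)) (full : Final (diagram S) p)
  (connected : Connected (diagram S) p) (a : Half (diagram S))
  {_~_ : Half (diagram S) → Half (diagram S) → Set} (equiv : IsEquivalence _~_)
  (strand-~ : ∀ d → d ~ strand (diagram S) p d)
  (arc-~ : ∀ d → d ≢ a → d ≢ opp (diagram S) a → d ~ opp (diagram S) d) where
  private
    D = diagram S
    open Checkerboard S using (coloring; module Colored)
    open Colored (proj₁ (coloring p full connected)) (proj₂ (coloring p full connected))
      using (color; color-strand)
    open IsEquivalence equiv using () renaming (refl to ~-refl; sym to ~-sym; trans to ~-trans)

    alternates = proj₂ (coloring p full connected)

    next : Half D → Half D
    next d = opp D (strand D p d)

    next-injective : ∀ {d e} → next d ≡ next e → d ≡ e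
    next-injective {d} {e} eq = begin
      d                                 ≡⟨ back d ⟨
      strand D p (opp D (next d))       ≡⟨ cong (strand D p ∘ opp D) eq ⟩
      strand D p (opp D (next e))       ≡⟨ back e ⟩
      e                                 ∎
      where
      open ≡-Reasoning
      back : ∀ d → strand D p (opp D (next d)) ≡ d
      back d = trans (cong (strand D p) (opp-involutive D _)) (strand-involutive D p d)

    walk : ℕ → Half D
    walk zero    = a
    walk (suc k) = next (walk k)

    color-walk : ∀ k → color (walk k) ≡ color a
    color-walk zero    = refl
    color-walk (suc k) = begin
      color (next (walk k))             ≡⟨ alternates _ ⟩
      not (color (strand D p (walk k))) ≡⟨ cong not (color-strand p full (walk k)) ⟩
      not (not (color (walk k)))        ≡⟨ not-involutive _ ⟩
      color (walk k)                    ≡⟨ color-walk k ⟩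
      color a                           ∎
      where open ≡-Reasoning

    leaving-≢ : ∀ k → strand D p (walk k) ≢ a
    leaving-≢ k eq = not-¬ (trans (cong color eq) (sym (color-walk k))) (color-strand p full (walk k))

    -- Until `opp D a` is met, the next arc is taken neither from `a`, by the colours, nor from
    -- `opp D a`, so `arc-~` applies to it.
    reached : ∀ k → a ~ walk k ⊎ a ~ opp D a
    reached zero = inj₁ ~-refl
    reached (suc k) with reached k
    ... | inj₂ done = inj₂ done
    ... | inj₁ here~ with strand D p (walk k) ≟ opp D a
    ...   | yes eq = inj₂ (subst (a ~_) eq (~-trans here~ (strand-~ _)))
    ...   | no ne  = inj₁ (~-trans here~ (~-trans (strand-~ _) (arc-~ _ (leaving-≢ k) ne)))

    cancel : ∀ k l → walk k ≡ walk (suc k + l) → a ≡ walk (suc l)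
    cancel zero    l eq = eq
    cancel (suc k) l eq = cancel k l (next-injective eq)

    -- The walk repeats itself by finiteness, and injectivity of `next` shifts the repetition back
    -- to the start.
    returns : ∃ λ l → a ≡ walk (suc l)
    returns with pigeonhole (n<1+n _) (encode ∘ walk ∘ toℕ)
      where encode = Inverse.from (enumeration (crossings D) (marks D))
    ... | i , j , i<j , eq with m≤n⇒∃[o]m+o≡n i<j
    ...   | l , i+l≡j = l , cancel (toℕ i) l (trans (encode-injective eq) (cong walk (sym i+l≡j)))
      where
      open Inverse (enumeration (crossings D) (marks D))
      encode-injective : ∀ {d e} → from d ≡ from e → d ≡ e
      encode-injective eq = trans (sym (strictlyInverseˡ _)) (trans (cong to eq) (strictlyInverseˡ _))

    cut-arc : a ~ opp D a
    cut-arc with returns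
    ... | l , eq with reached l
    ...   | inj₂ done = done
    -- Returning to `a` means that the last vertex was left by `opp D a`.
    ...   | inj₁ here~ = subst (a ~_) (trans (sym (opp-involutive D _)) (cong (opp D) (sym eq)))
      (~-trans here~ (strand-~ (walk l)))

    arc-anywhere : ∀ d → d ~ opp D d
    arc-anywhere d with d ≟ a | d ≟ opp D a
    ... | yes refl | _ = cut-arc
    ... | no _ | yes refl = subst (opp D a ~_) (sym (opp-involutive D a)) (~-sym cut-arc)
    ... | no d≢a | no d≢a′ = arc-~ d d≢a d≢a′

  -- A closed curve minus an arc is still a path. The relation will be connectedness inside the
  -- connect sum, where the arc of `a` is missing.
  connected-without-arc : ∀ d e → d ~ e
  connected-without-arc d e = Eq.fold equiv step (connected d e)
    where
    step : ∀ {d e} → Game.Joined D p d e → d ~ e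
    step {d} joined with joined-cases D p full joined
    ... | inj₁ refl = ~-refl
    ... | inj₂ (inj₁ refl) = arc-anywhere d
    ... | inj₂ (inj₂ refl) = strand-~ d

-- Summands of a connect sum

whole : ∀ D → Summand D 0 D
whole D = record
  { combine        = λ p _ → p
  ; inside         = λ c → c
  ; outside        = λ ()
  ; cover          = λ c → inj₁ (c , refl)
  ; lookup-inside  = λ _ _ _ → refl
  ; lookup-outside = λ _ _ ()
  ; update-inside  = λ _ _ _ _ → refl
  ; update-outside = λ _ _ ()
  ; restrict       = λ _ _ connected → connected
  }

summand-of : ∀ m n (c : Fin (m + n)) → (∃ λ i → i ↑ˡ n ≡ c) ⊎ (∃ λ j → m ↑ʳ j ≡ c)
summand-of m n c with splitAt m c in eq
... | inj₁ i = inj₁ (i , splitAt⁻¹-↑ˡ eq)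
... | inj₂ j = inj₂ (j , splitAt⁻¹-↑ʳ eq)

module _ (D₁ D₂ : Diagram) (a : Half D₁) (b : Half D₂) where
  private
    n₁ = crossings D₁
    n₂ = crossings D₂
    E = connectSum D₁ D₂ a b
    π = split D₁ D₂
    ι = join D₁ D₂
    ρ = reconnect D₁ D₂ a b

  data Step (p : Position D₁) (q : Position D₂) :
      Half D₁ ⊎ Half D₂ → Half D₁ ⊎ Half D₂ → Set where
    arc   : ∀ z → Step p q z (ρ z)
    left  : ∀ {d e} → Game.Joined D₁ p d e → Step p q (inj₁ d) (inj₁ e)
    right : ∀ {d e} → Game.Joined D₂ q d e → Step p q (inj₂ d) (inj₂ e)

  step : ∀ {p q d e} → Game.Joined E (p ++ q) d e → Step p q (π d) (π e)
  step (Game.arc d) = subst (Step _ _ (π d)) (sym (split-join D₁ D₂ _)) (arc (π d))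
  step (Game.mark q i k) with splitAt (marks D₁) q
  ... | inj₁ q₁ = left (Game.mark q₁ i k)
  ... | inj₂ q₂ = right (Game.mark q₂ i k)
  step {p} {q} (Game.precrossing c free i k) with splitAt n₁ c in eq
  ... | inj₁ c₁ = left (Game.precrossing c₁
    (trans (sym (lookup-++ˡ p q c₁)) (trans (cong (lookup (p ++ q)) (splitAt⁻¹-↑ˡ eq)) free)) i k)
  ... | inj₂ c₂ = right (Game.precrossing c₂
    (trans (sym (lookup-++ʳ p q c₂)) (trans (cong (lookup (p ++ q)) (splitAt⁻¹-↑ʳ eq)) free)) i k)
  step {p} {q} (Game.smoothed c s done i) with splitAt n₁ c in eq
  ... | inj₁ c₁ = left (Game.smoothed c₁ s
    (trans (sym (lookup-++ˡ p q c₁)) (trans (cong (lookup (p ++ q)) (splitAt⁻¹-↑ˡ eq)) done)) i)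
  ... | inj₂ c₂ = right (Game.smoothed c₂ s
    (trans (sym (lookup-++ʳ p q c₂)) (trans (cong (lookup (p ++ q)) (splitAt⁻¹-↑ʳ eq)) done)) i)

  -- Collapsing `D₂` to the half-edge `a` maps paths to paths: of the two new arcs, one shrinks to
  -- `a` and the other becomes the old arc of `a`.
  restrict-left : ∀ p q → Connected E (p ++ q) → Connected D₁ p
  restrict-left p q connected d e = subst₂ (EqClosure (Game.Joined D₁ p))
    (cong project (split-join D₁ D₂ (inj₁ d))) (cong project (split-join D₁ D₂ (inj₁ e)))
    (Eq.gfold (Eq.isEquivalence _) (project ∘ π) (λ joined → projected (step joined))
      (connected (ι (inj₁ d)) (ι (inj₁ e))))
    where
    project : Half D₁ ⊎ Half D₂ → Half D₁
    project (inj₁ d) = d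
    project (inj₂ _) = a
    projected : ∀ {y z} → Step p q y z → EqClosure (Game.Joined D₁ p) (project y) (project z)
    projected (left joined) = Eq.return joined
    projected (right _) = Eq.reflexive _
    projected (arc (inj₁ d)) with d ≟ a
    ... | yes refl = Eq.reflexive _
    ... | no _ with d ≟ opp D₁ a
    ...   | yes refl = Eq.symmetric _ (Eq.return (Game.arc a))
    ...   | no _ = Eq.return (Game.arc d)
    projected (arc (inj₂ e)) with e ≟ b
    ... | yes _ = Eq.return (Game.arc a)
    ... | no _ with e ≟ opp D₂ b
    ...   | yes _ = Eq.reflexive _
    ...   | no _ = Eq.reflexive _

  restrict-right : ∀ p q → Connected E (p ++ q) → Connected D₂ q
  restrict-right p q connected d e = subst₂ (EqClosure (Game.Joined D₂ q))
    (cong project (split-join D₁ D₂ (inj₂ d))) (cong project (split-join D₁ D₂ (inj₂ e)))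
    (Eq.gfold (Eq.isEquivalence _) (project ∘ π) (λ joined → projected (step joined))
      (connected (ι (inj₂ d)) (ι (inj₂ e))))
    where
    project : Half D₁ ⊎ Half D₂ → Half D₂
    project (inj₁ _) = b
    project (inj₂ e) = e
    projected : ∀ {y z} → Step p q y z → EqClosure (Game.Joined D₂ q) (project y) (project z)
    projected (left _) = Eq.reflexive _
    projected (right joined) = Eq.return joined
    projected (arc (inj₁ d)) with d ≟ a
    ... | yes _ = Eq.return (Game.arc b)
    ... | no _ with d ≟ opp D₁ a
    ...   | yes _ = Eq.reflexive _
    ...   | no _ = Eq.reflexive _
    projected (arc (inj₂ e)) with e ≟ b
    ... | yes refl = Eq.reflexive _
    ... | no _ with e ≟ opp D₂ b
    ...   | yes refl = Eq.symmetric _ (Eq.return (Game.arc b))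
    ...   | no _ = Eq.return (Game.arc e)

  left-summand : Summand D₁ n₂ E
  left-summand = record
    { combine        = _++_
    ; inside         = _↑ˡ n₂
    ; outside        = n₁ ↑ʳ_
    ; cover          = summand-of n₁ n₂
    ; lookup-inside  = lookup-++ˡ
    ; lookup-outside = lookup-++ʳ
    ; update-inside  = λ p q c _ → []≔-++-↑ˡ p q c
    ; update-outside = λ p q c _ → []≔-++-↑ʳ p q c
    ; restrict       = restrict-left
    }

  right-summand : Summand D₂ n₁ E
  right-summand = record
    { combine        = λ q p → p ++ q
    ; inside         = n₁ ↑ʳ_
    ; outside        = _↑ˡ n₂
    ; cover          = swap ∘ summand-of n₁ n₂
    ; lookup-inside  = λ q p → lookup-++ʳ p q
    ; lookup-outside = λ q p → lookup-++ˡ p q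
    ; update-inside  = λ q p c _ → []≔-++-↑ʳ p q c
    ; update-outside = λ q p c _ → []≔-++-↑ˡ p q c
    ; restrict       = λ q p → restrict-right p q
    }

  module _ (p : Position D₁) (q : Position D₂) where
    private
      _~_ : Half D₁ ⊎ Half D₂ → Half D₁ ⊎ Half D₂ → Set
      y ~ z = EqClosure (Game.Joined E (p ++ q)) (ι y) (ι z)

    sum-arc : ∀ z → z ~ ρ z
    sum-arc z = subst (λ y → EqClosure (Game.Joined E (p ++ q)) (ι z) (ι (ρ y))) (split-join D₁ D₂ z)
      (Eq.return (Game.arc (ι z)))

    sum-strand-left : ∀ d → inj₁ d ~ inj₁ (strand D₁ p d)
    sum-strand-left (inj₁ (c , i)) with lookup p c in eq
    ... | just s  = Eq.return (Game.smoothed (c ↑ˡ n₂) s (trans (lookup-++ˡ p q c) eq) i)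
    ... | nothing = Eq.reflexive _
    sum-strand-left (inj₂ (m , i)) = Eq.return (Game.mark (m ↑ˡ marks D₂) i (rotate₂ i))

    sum-strand-right : ∀ d → inj₂ d ~ inj₂ (strand D₂ q d)
    sum-strand-right (inj₁ (c , i)) with lookup q c in eq
    ... | just s  = Eq.return (Game.smoothed (n₁ ↑ʳ c) s (trans (lookup-++ʳ p q c) eq) i)
    ... | nothing = Eq.reflexive _
    sum-strand-right (inj₂ (m , i)) = Eq.return (Game.mark (marks D₁ ↑ʳ m) i (rotate₂ i))

    sum-arc-left : ∀ d → d ≢ a → d ≢ opp D₁ a → inj₁ d ~ inj₁ (opp D₁ d)
    sum-arc-left d d≢a d≢a′ with d ≟ a | d ≟ opp D₁ a | sum-arc (inj₁ d)
    ... | yes eq | _      | _ = contradiction eq d≢a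
    ... | no _   | yes eq | _ = contradiction eq d≢a′
    ... | no _   | no _   | joined = joined

    sum-arc-right : ∀ e → e ≢ b → e ≢ opp D₂ b → inj₂ e ~ inj₂ (opp D₂ e)
    sum-arc-right e e≢b e≢b′ with e ≟ b | e ≟ opp D₂ b | sum-arc (inj₂ e)
    ... | yes eq | _      | _ = contradiction eq e≢b
    ... | no _   | yes eq | _ = contradiction eq e≢b′
    ... | no _   | no _   | joined = joined

    sum-bridge : inj₁ a ~ inj₂ (opp D₂ b)
    sum-bridge with a ≟ a | sum-arc (inj₁ a)
    ... | yes _  | joined = joined
    ... | no a≢a | _ = contradiction refl a≢a

-- Both loops survive the cut as paths, and the new arc from `a` to `opp D₂ b` links them.
glue : (S₁ S₂ : Shadow) → let D₁ = diagram S₁ ; D₂ = diagram S₂ in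
  ∀ a b p q → Final D₁ p → Final D₂ q → Connected D₁ p → Connected D₂ q →
  Connected (connectSum D₁ D₂ a b) (p ++ q)
glue S₁ S₂ a b p q full₁ full₂ connected₁ connected₂ d e =
  subst₂ (EqClosure (Game.Joined (connectSum D₁ D₂ a b) (p ++ q)))
    (join-split D₁ D₂ d) (join-split D₁ D₂ e)
    (Eq.transitive _ (to-hub (split D₁ D₂ d)) (Eq.symmetric _ (to-hub (split D₁ D₂ e))))
  where
  D₁ = diagram S₁
  D₂ = diagram S₂
  _~_ : Half D₁ ⊎ Half D₂ → Half D₁ ⊎ Half D₂ → Set
  y ~ z = EqClosure (Game.Joined (connectSum D₁ D₂ a b) (p ++ q)) (join D₁ D₂ y) (join D₁ D₂ z)
  to-hub : ∀ z → z ~ inj₁ a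
  to-hub (inj₁ d) = connected-without-arc S₁ p full₁ connected₁ a
    (On.isEquivalence (join D₁ D₂ ∘ inj₁) (Eq.isEquivalence _))
    (sum-strand-left D₁ D₂ a b p q) (sum-arc-left D₁ D₂ a b p q) d a
  to-hub (inj₂ e) = Eq.transitive _ (connected-without-arc S₂ q full₂ connected₂ b
    (On.isEquivalence (join D₁ D₂ ∘ inj₂) (Eq.isEquivalence _))
    (sum-strand-right D₁ D₂ a b p q) (sum-arc-right D₁ D₂ a b p q) e (opp D₂ b))
    (Eq.symmetric _ (sum-bridge D₁ D₂ a b p q))

-- Strategies in the connect sum

parity? : (n : ℕ) → parity n ≡ 0ℙ ⊎ parity n ≡ 1ℙ
parity? n with parity n
... | 0ℙ = inj₁ refl
... | 1ℙ = inj₂ refl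

flip-parity : ∀ {n} (p : Vec State n) c s {x} → lookup p c ≡ nothing →
  parity (remaining p) ≡ x → parity (remaining (p [ c ]≔ just s)) ≡ x ℙ.⁻¹
flip-parity p c s free eq = trans (parity-move p c s free) (cong ℙ._⁻¹ eq)

odd⇒playable : ∀ {n} (p : Vec State n) → parity (remaining p) ≡ 1ℙ → ¬ Exhausted p
odd⇒playable p odd full with () ← trans (sym (cong parity (exhausted⇒remaining≡0 p full))) odd

module _ {A B E : Diagram} (S : Summand A (crossings B) E)
  (glued : ∀ p q → Final A p → Final B q → Connected A p → Connected B q →
    Connected E (Summand.combine S p q)) where
  open Summand S

  final-both : ∀ p q → Final A p → Final B q → Final E (combine p q)
  final-both p q full₁ full₂ c free with cover c
  ... | inj₁ (d , refl) = full₁ d (trans (sym (lookup-inside p q d)) free)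
  ... | inj₂ (d , refl) = full₂ d (trans (sym (lookup-outside p q d)) free)

  final-outside : ∀ p q → Final E (combine p q) → Final B q
  final-outside p q full c free = full (outside c) (trans (lookup-outside p q c) free)

  -- `K` carries a strategy for each summand. Parity ensures that `L` never makes the last move in a
  -- summand, which would leave `K` without a reply there.
  K-replies : ∀ {p q} → CanWin A K L p → CanWin B K L q →
    parity (remaining p) ≡ 0ℙ → parity (remaining q) ≡ 0ℙ → CanWin E K L (combine p q)
  K-moves-inside : ∀ {p q} → CanWin A K K p → CanWin B K L q →
    parity (remaining p) ≡ 1ℙ → parity (remaining q) ≡ 0ℙ → CanWin E K K (combine p q)
  K-moves-outside : ∀ {p q} → CanWin A K L p → CanWin B K K q →
    parity (remaining p) ≡ 0ℙ → parity (remaining q) ≡ 1ℙ → CanWin E K K (combine p q)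

  K-replies {p} {q} (over full₁ won₁) (over full₂ won₂) even₁ even₂ =
    over (final-both p q full₁ full₂) (glued p q full₁ full₂ won₁ won₂)
  K-replies {p} {q} w₁@(reply _ playable answers) w₂@(over full₂ _) even₁ even₂ =
    answer S K p q (λ full → playable (final-inside S p q full))
      (λ c free s → K-moves-inside (answers c free s) w₂ (flip-parity p c s free even₁) even₂)
      (λ c free s → contradiction free (full₂ c))
  K-replies {p} {q} w₁@(over full₁ _) w₂@(reply _ playable answers) even₁ even₂ =
    answer S K p q (λ full → playable (final-outside p q full))
      (λ c free s → contradiction free (full₁ c))
      (λ c free s → K-moves-outside w₁ (answers c free s) even₁ (flip-parity q c s free even₂))
  K-replies {p} {q} w₁@(reply _ playable answers₁) w₂@(reply _ _ answers₂) even₁ even₂ =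
    answer S K p q (λ full → playable (final-inside S p q full))
      (λ c free s → K-moves-inside (answers₁ c free s) w₂ (flip-parity p c s free even₁) even₂)
      (λ c free s → K-moves-outside w₁ (answers₂ c free s) even₁ (flip-parity q c s free even₂))

  K-moves-inside {p} (over full _) w₂ odd₁ even₂ = contradiction full (odd⇒playable p odd₁)
  K-moves-inside {p} {q} (move c free s w₁) w₂ odd₁ even₂ =
    move-inside S K p q c free s (K-replies w₁ w₂ (flip-parity p c s free odd₁) even₂)
  K-moves-inside (reply K≢K _ _) w₂ odd₁ even₂ = contradiction refl K≢K

  K-moves-outside {q = q} w₁ (over full _) even₁ odd₂ = contradiction full (odd⇒playable q odd₂)
  K-moves-outside {p} {q} w₁ (move c free s w₂) even₁ odd₂ =
    move-outside S K p q c free s (K-replies w₁ w₂ even₁ (flip-parity q c s free odd₂))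
  K-moves-outside w₁ (reply K≢K _ _) even₁ odd₂ = contradiction refl K≢K

P⇒even : ∀ {D} → Tait D → P-position D → parity (crossings D) ≡ 0ℙ
P⇒even {D} T (K-second , _) with parity? (crossings D)
... | inj₁ even = even
... | inj₂ odd = ⊥-elim (one-winner K-second
  (odd-wins (whole D) T (start D) [] (trans (cong parity (remaining-replicate (crossings D))) odd)))

-- In an even diagram the opening move of `K` leaves an odd number of free crossings with `L` to
-- move. Without crossings the start is final, and not both players can have won.
N⇒odd : ∀ {D} → Tait D → N-position D → parity (crossings D) ≡ 1ℙ
N⇒odd {D} T (K-first , L-first) with parity? (crossings D)
... | inj₂ odd = odd
... | inj₁ even with K-first
...   | over full connected with L-first
...     | over _ disconnected = contradiction connected disconnected
...     | move c free _ _     = contradiction free (full c)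
...     | reply L≢L _ _       = contradiction refl L≢L
N⇒odd {D} T _ | inj₁ even | reply K≢K _ _ = contradiction refl K≢K
N⇒odd {D} T _ | inj₁ even | move c free s won = ⊥-elim (one-winner won
  (odd-wins (whole D) T (start D [ c ]≔ just s) []
    (flip-parity (start D) c s free (trans (cong parity (remaining-replicate (crossings D))) even))))

module _ {A B E : Diagram} (S : Summand A (crossings B) E) (T : Summand B (crossings A) E)
  (same : ∀ p q → Summand.combine T q p ≡ Summand.combine S p q)
  (tait-A : Tait A) (tait-B : Tait B) where
  open Summand S

  odd-inside : ∀ p q → parity (remaining p) ≡ 1ℙ → CanWin E L L (combine p q)
  odd-inside = odd-wins S tait-A

  odd-outside : ∀ p q → parity (remaining q) ≡ 1ℙ → CanWin E L L (combine p q)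
  odd-outside p q odd = subst (CanWin E L L) (same p q) (odd-wins T tait-B q p odd)

  -- Replying in `B` can fail only if `B` is odd, and then `L` wins by moving first in `B`, whatever
  -- happens in `A`.
  L-first : ∀ p q → CanWin A L L p → CanWin E L L (combine p q)
  L-first p q won with parity? (remaining q)
  ... | inj₁ even = even-elsewhere S _ L p q refl even won
  ... | inj₂ odd  = odd-outside p q odd

  -- If B is odd, then K must start in B, which makes B even and leaves the first
  -- move in A to L: otherwise L moves first in the odd B.
  L-second : ∀ p q → CanWin A L L p → CanWin A L K p → CanWin E L K (combine p q)
  L-second p q first second with parity? (remaining q)
  ... | inj₁ even = even-elsewhere S _ K p q refl even second
  ... | inj₂ odd  = answer S L p q
    (λ full → odd⇒playable q odd (λ c free → full (outside c) (trans (lookup-outside p q c) free)))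
    (λ c free s → odd-outside _ q odd)
    (λ c free s → even-elsewhere S _ L p _ refl (flip-parity q c s free odd) first)

  -- The first move of `K` leaves one summand untouched, hence odd, with `L` to move.
  two-odd : ∀ p q → parity (remaining p) ≡ 1ℙ → parity (remaining q) ≡ 1ℙ → CanWin E L K (combine p q)
  two-odd p q odd₁ odd₂ = answer S L p q (λ full → odd⇒playable p odd₁ (final-inside S p q full))
    (λ c free s → odd-outside _ q odd₂)
    (λ c free s → odd-inside p _ odd₁)

replicate-++ : ∀ {A : Set} m n (x : A) → replicate (m + n) x ≡ replicate m x ++ replicate n x
replicate-++ zero    n x = refl
replicate-++ (suc m) n x = cong (x ∷_) (replicate-++ m n x)

proposition13 :
    (D₁ D₂ : Shadow) (a : Half (diagram D₁)) (b : Half (diagram D₂)) →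
    OnExterior D₁ a → OnExterior D₂ b →
    let E₁ = diagram D₁
        E₂ = diagram D₂
        E  = connectSum E₁ E₂ a b
    in (P-position E₁ × P-position E₂ → P-position E)
     × (P-position E₁ × N-position E₂ → N-position E)
     × (N-position E₁ × N-position E₂ → L-position E)
     × (L-position E₁ ⊎ L-position E₂ → L-position E)
proposition13 D₁ D₂ a b _ _ = PP , PN , NN , λ where
    (inj₁ (first , second)) →
      at-start (L-first S₁ S₂ same T₁ T₂ p q first) ,
      at-start (L-second S₁ S₂ same T₁ T₂ p q first second)
    (inj₂ (first , second)) →
      at-start (L-first S₂ S₁ same′ T₂ T₁ q p first) ,
      at-start (L-second S₂ S₁ same′ T₂ T₁ q p first second)
  where
  E₁ = diagram D₁
  E₂ = diagram D₂
  E  = connectSum E₁ E₂ a b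
  S₁ = left-summand E₁ E₂ a b
  S₂ = right-summand E₁ E₂ a b
  T₁ = Checkerboard.tait D₁
  T₂ = Checkerboard.tait D₂
  same : ∀ r s → Summand.combine S₂ s r ≡ Summand.combine S₁ r s
  same _ _ = refl
  same′ : ∀ s r → Summand.combine S₁ r s ≡ Summand.combine S₂ s r
  same′ _ _ = refl
  p = start E₁
  q = start E₂

  glued = λ r s → glue D₁ D₂ a b r s

  at-start : ∀ {X Y} → CanWin E X Y (p ++ q) → CanWin E X Y (start E)
  at-start {X} {Y} = subst (CanWin E X Y) (sym (replicate-++ (crossings E₁) (crossings E₂) nothing))

  parity-start : ∀ D {x} → parity (crossings D) ≡ x → parity (remaining (start D)) ≡ x
  parity-start D = trans (cong parity (remaining-replicate (crossings D)))

  PP : P-position E₁ × P-position E₂ → P-position E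
  PP (P₁@(K₁ , L₁) , P₂@(K₂ , _)) =
    at-start (K-replies S₁ glued K₁ K₂ even₁ even₂) ,
    -- Disconnecting one summand suffices for `L`, so only the strategy in `E₁` is followed.
    at-start (even-elsewhere S₁ _ K p q refl even₂ L₁)
    where
    even₁ = parity-start E₁ (P⇒even T₁ P₁)
    even₂ = parity-start E₂ (P⇒even T₂ P₂)

  PN : P-position E₁ × N-position E₂ → N-position E
  PN (P₁@(K₁ , _) , N₂@(K₂ , _)) =
    at-start (K-moves-outside S₁ glued K₁ K₂ even odd) ,
    at-start (odd-outside S₁ S₂ same T₁ T₂ p q odd)
    where
    even = parity-start E₁ (P⇒even T₁ P₁)
    odd  = parity-start E₂ (N⇒odd T₂ N₂)

  NN : N-position E₁ × N-position E₂ → L-position E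
  NN (N₁ , N₂) =
    at-start (odd-inside S₁ S₂ same T₁ T₂ p q odd₁) ,
    at-start (two-odd S₁ S₂ same T₁ T₂ p q odd₁ odd₂)
    where
    odd₁ = parity-start E₁ (N⇒odd T₁ N₁)
    odd₂ = parity-start E₂ (N⇒odd T₂ N₂)
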